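{- Let $G$ be a $4$-boundary regular critical graph in the plane with boundary of size $n$. Then $$f_4(n)=\binom{n/2}{2}+n\quad\text{if } n \text{ is even},\qquad f_4(n)=0\quad\text{otherwise},$$ where $f_4(n)$ is the supremum of the numbers of vertices of $4$-boundary regular critical graphs in the plane with $n$ boundary points.
   Context: Graphs are drawn in the Euclidean plane so that each edge is a straight line segment; edges are allowed to cross each other, and the intersection point of two edges is a vertex of the graph. A boundary point is a vertex incident to only one edge; the set of boundary points is finite, and its cardinality is the size of the boundary. Vertices of degree $2$ are not allowed, the graph is bounded (entirely contained in a bounded open set of the plane), and it has countably many vertices. Such a graph is critical if, at each non-boundary vertex, the sum of the unit vectors of the edges extending from that vertex is zero. It is $4$-boundary regular if every non-boundary vertex has degree $4$. The number of vertices counts all vertices, including boundary points. The quantity $f_4(n)$ is defined for $n\ge 3$; the value $f_4(n)=0$ for odd $n$ expresses that no $4$-boundary regular critical graph with $n$ boundary points exists.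
   Formalization: The supremum and the nonexistence for odd n range over graphs with finitely many vertices only; with countably infinite graphs the claim fails (right-angled pentagon tiling in the Klein disc with n of its chords cut short). -}

module Defs where

open import Algebra.Bundles using (CommutativeRing)
import Algebra.Properties.Monoid.Sum as MonoidSum
open import Data.Fin.Base using (Fin)
open import Data.Nat.Base as ℕ using (ℕ)
open import Data.Product.Base using (Σ-syntax; ∃; ∃-syntax; _×_; _,_; proj₁; proj₂)
open import Data.Sum.Base using (_⊎_)
open import Level using (0ℓ)
open import Function.Base using (_∘_)
open import Function.Bundles using (_↔_; _↣_)
open import Function.Definitions using (Injective)
open import Relation.Binary.Core using (Rel)
open import Relation.Binary.Definitions using (Symmetric; Irreflexive)
open import Relation.Binary.PropositionalEquality.Core using (_≡_)
open import Relation.Binary.Structures using (IsStrictTotalOrder)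
import Relation.Binary.Construct.StrictToNonStrict as StrictToNonStrict
open import Relation.Nullary.Negation.Core using (¬_)

-- The classical axioms of a Dedekind-complete ordered field, which
-- characterise ℝ up to unique isomorphism.  (The standard library has no
-- construction of ℝ, so the plane is built over an arbitrary such field.)
record RealField : Set₁ where
  field
    commutativeRing : CommutativeRing 0ℓ 0ℓ
  open CommutativeRing commutativeRing public
  infix 4 _<_
  field
    _<_                : Rel Carrier 0ℓ
    isStrictTotalOrder : IsStrictTotalOrder _≈_ _<_

  open StrictToNonStrict _≈_ _<_ public using (_≤_)

  IsUpperBound : (Carrier → Set) → Carrier → Set
  IsUpperBound P b = ∀ x → P x → x ≤ b

  field
    0<1      : 0# < 1#
    +-mono-< : ∀ {x y} z → x < y → x + z < y + z
    *-pos    : ∀ {x y} → 0# < x → 0# < y → 0# < x * y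
    inverse  : ∀ x → ¬ x ≈ 0# → ∃[ y ] x * y ≈ 1#
    complete : ∀ (P : Carrier → Set) → ∃ P → ∃ (IsUpperBound P) →
               ∃[ s ] IsUpperBound P s × (∀ b → IsUpperBound P b → s ≤ b)

record Enumeration {A : Set} (P : A → Set) (n : ℕ) : Set where
  field
    elem      : Fin n → A
    injective : Injective _≡_ _≡_ elem
    sound     : ∀ i → P (elem i)
    complete  : ∀ {x} → P x → ∃[ i ] elem i ≡ x

module Plane (𝓡 : RealField) where
  open RealField 𝓡
  open MonoidSum +-monoid using (sum)

  Point : Set
  Point = Carrier × Carrier

  infix 4 _≈ₚ_
  _≈ₚ_ : Rel Point 0ℓ
  (x , y) ≈ₚ (x′ , y′) = x ≈ x′ × y ≈ y′

  infixl 6 _+ₚ_ _-ₚ_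
  _+ₚ_ _-ₚ_ : Point → Point → Point
  (x , y) +ₚ (x′ , y′) = (x + x′ , y + y′)
  (x , y) -ₚ (x′ , y′) = (x - x′ , y - y′)

  infixr 7 _·_
  _·_ : Carrier → Point → Point
  t · (x , y) = (t * x , t * y)

  ∥_∥² : Point → Carrier
  ∥ (x , y) ∥² = x * x + y * y

  sumₚ : ∀ {n} → (Fin n → Point) → Point
  sumₚ u = (sum (proj₁ ∘ u) , sum (proj₂ ∘ u))

  OnSegment : Point → Point → Point → Set
  OnSegment P Q X = ∃[ t ] 0# ≤ t × t ≤ 1# × X ≈ₚ P +ₚ t · (Q -ₚ P)

  -- U = (Q - P) / ∥ Q - P ∥, phrased without a square root (the t below is
  -- necessarily ∥ Q - P ∥).
  UnitVector : Point → Point → Point → Set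
  UnitVector P Q U = ∥ U ∥² ≈ 1# × (∃[ t ] 0# < t × Q -ₚ P ≈ₚ t · U)

  -- Edges are adjacent pairs of vertices: two straight edges with the same
  -- ends would coincide as drawings.
  record Graph : Set₁ where
    field
      Vertex       : Set
      position     : Vertex → Point
      position-inj : ∀ {v w} → position v ≈ₚ position w → v ≡ w
      countable    : Vertex ↣ ℕ
      Adj          : Rel Vertex 0ℓ
      adj-sym      : Symmetric Adj
      adj-irrefl   : Irreflexive _≡_ Adj

    SameEdge : Vertex → Vertex → Vertex → Vertex → Set
    SameEdge a b c d = (a ≡ c × b ≡ d) ⊎ (a ≡ d × b ≡ c)

    OnEdge : Vertex → Vertex → Point → Set
    OnEdge a b = OnSegment (position a) (position b)

    OnGraph : Point → Set
    OnGraph X = (∃[ v ] X ≈ₚ position v) ⊎ (∃[ a ] ∃[ b ] Adj a b × OnEdge a b X)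

    HasDegree : Vertex → ℕ → Set
    HasDegree v = Enumeration (Adj v)

    IsBoundary : Vertex → Set
    IsBoundary v = HasDegree v 1

    HasBoundarySize : ℕ → Set
    HasBoundarySize = Enumeration IsBoundary

    field
      -- Where edges cross there is a vertex, and that vertex subdivides
      -- them; so distinct edges only meet at a common end.
      crossing    : ∀ {a b c d X} → Adj a b → Adj c d → ¬ SameEdge a b c d →
                    OnEdge a b X → OnEdge c d X →
                    ∃[ v ] X ≈ₚ position v × (v ≡ a ⊎ v ≡ b) × (v ≡ c ⊎ v ≡ d)
      no-degree-2 : ∀ v → ¬ HasDegree v 2
      bounded     : ∃[ ρ ] ∀ X → OnGraph X → ∥ X ∥² < ρ

  module _ (G : Graph) where
    open Graph G

    -- The sum at a vertex is only meaningful for finite degree d.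
    Balanced : Vertex → Set
    Balanced v = ∃[ d ] Σ[ nbr ∈ HasDegree v d ] Σ[ u ∈ (Fin d → Point) ]
      (∀ i → UnitVector (position v) (position (Enumeration.elem nbr i)) (u i)) ×
      sumₚ u ≈ₚ (0# , 0#)

    Critical : Set
    Critical = ∀ v → ¬ IsBoundary v → Balanced v

    BoundaryRegular : ℕ → Set
    BoundaryRegular k = ∀ v → ¬ IsBoundary v → HasDegree v k

    HasVertexCount : ℕ → Set
    HasVertexCount N = Fin N ↔ Vertex

  VertexCount : (k n N : ℕ) → Set₁
  VertexCount k n N = ∃[ G ]
    Critical G × BoundaryRegular G k × Graph.HasBoundarySize G n × HasVertexCount G N

  -- The supremum is over natural numbers: infinite graphs contribute no vertex
  -- count (the Klein disc model of a {5,4} tiling is an infinite example), and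
  -- the empty set has supremum 0.
  IsSupremum : (ℕ → Set₁) → ℕ → Set₁
  IsSupremum S s = (∀ N → S N → N ℕ.≤ s) × (∀ b → (∀ N → S N → N ℕ.≤ b) → s ℕ.≤ b)

  -- "f_k(n) = s"
  f[_]⟨_⟩≡_ : (k n s : ℕ) → Set₁
  f[ k ]⟨ n ⟩≡ s = IsSupremum (VertexCount k n) s

{-# OPTIONS --safe #-}
module Submission where

-- Four unit vectors with sum zero form two opposite pairs, so every interior
-- vertex is the transversal crossing of two straight lines.  Going straight on
-- from a boundary point must end, the graph being finite, at another boundary
-- point; this fixpoint-free involution τ makes n = 2m even.  An interior vertex
-- is determined by one end of each of its two lines and so yields eight pairs of
-- boundary points, none of them of the form (i , i) or (i , τ i); hence
-- 8 (N - n) + 2n ≤ n², that is, N ≤ C(m, 2) + n.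
--
-- The bound is attained by m tangent lines of a parabola: no three of them
-- concur, and every two of them cross.

-- The count is over names of lines by their ends, not over lines, so the quotient of the boundary
-- by τ is never formed. A crossing of two lines has 2 · 2 · 2 names: the order of the lines and a
-- chosen end on each. Boundary points are padded to eight slots as well, so that the whole bound is
-- one injection out of `Vertex × Fin 8` and the interior vertices are never enumerated separately.
--
-- The parabola turns the drawing into combinatorics. Its tangents at s and t meet in (s + t , s t),
-- so on every tangent the crossings appear in the order of the other parameter, and incidence
-- reduces to comparing pairs of numbers. The obstacle is metric: `UnitVector` asks for the length
-- of each edge as an element of the field, so the slopes are chosen such that the tangents have
-- direction vectors of known length.

open import Algebra.Bundles using (CommutativeRing; RawRing)
import Algebra.Properties.AbelianGroup as AbelianGroupProperties
import Algebra.Properties.CommutativeMonoid.Sum as CommutativeMonoidSum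
import Algebra.Properties.CommutativeSemigroup as CommutativeSemigroupProperties
import Algebra.Properties.Group as GroupProperties
import Algebra.Properties.Ring as RingProperties
import Algebra.Properties.Semiring.Mult.TCOptimised as SemiringMult
import Algebra.Solver.Ring as RingSolver
open import Algebra.Solver.Ring.AlmostCommutativeRing using (fromCommutativeRing; _-Raw-AlmostCommutative⟶_)
open import Data.Bool.Base using (if_then_else_)
open import Data.Empty using (⊥; ⊥-elim)
open import Data.Fin using (Fin; zero; suc; opposite)
import Data.Fin.Base as Fin
open import Data.Fin.Induction using (spo-noetherian)
open import Data.Fin.Permutation using (permutation)
import Data.Fin.Properties as Fin
open import Data.Maybe.Base using (Maybe)
import Data.Maybe.Base as Maybe
open import Data.Nat using (ℕ)
import Data.Nat.Base as ℕ
open import Data.Nat.Combinatorics using (_C_; nCk+nC[k+1]≡[n+1]C[k+1]; nC1≡n)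
open import Data.Nat.Divisibility using (_∣_; divides)
open import Data.Nat.DivMod using (m*n/n≡m)
import Data.Nat.Properties as ℕ
open import Data.Nat.Solver using (module +-*-Solver)
open import Data.Product using (_×_; _,_; proj₁; proj₂; ∃-syntax)
import Data.Product as Product
open import Data.Product.Function.NonDependent.Propositional using (_×-↔_)
open import Data.Product.Properties using (≡-dec; ,-injective)
open import Data.Sum using (_⊎_; inj₁; inj₂; [_,_]′)
import Data.Sum as Sum
open import Data.Sum.Function.Propositional using (_⊎-↔_)
open import Data.Sum.Properties using (inj₁-injective)
open import Data.Vec using (Vec; []; _∷_; lookup)
open import Data.Vec.Relation.Unary.All using (All; []; _∷_)
import Data.Vec.Relation.Unary.All.Properties as All
open import Data.Vec.Relation.Unary.AllPairs using ([]; _∷_)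
open import Data.Vec.Relation.Unary.Any using (Any; here; there; index)
open import Data.Vec.Relation.Unary.Any.Properties using (lookup-index)
open import Data.Vec.Relation.Unary.Unique.Propositional using (Unique)
open import Data.Vec.Relation.Unary.Unique.Propositional.Properties using (lookup-injective)
open import Defs
open import Function using (_∘_; case_of_; _↔_; _↣_; mk↣; mk↔ₛ′; Inverse; Injection)
open import Function.Construct.Composition using (_↔-∘_; _↣-∘_)
open import Function.Properties.Inverse using (↔⇒↣; ↔-sym; ↔-refl)
open import Induction.WellFounded using (Acc; acc)
open import Level using (0ℓ)
import Relation.Binary.Construct.On as On
import Relation.Binary.Construct.StrictToNonStrict as StrictToNonStrict
open import Relation.Binary.Consequences using (dec⇒weaklyDec)
open import Relation.Binary.Definitions using (tri<; tri≈; tri>)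
open import Relation.Binary.PropositionalEquality as ≡ using (_≡_; _≢_)
import Relation.Binary.Reasoning.Setoid as SetoidReasoning
open import Relation.Binary.Structures using (IsStrictTotalOrder)
open import Relation.Nullary using (¬_; Dec; yes; no; contradiction)
open import Relation.Nullary.Decidable using (map′; from-yes; ¬?; ⌊_⌋)

-- Polynomial identities over a commutative ring.

-- The ring solver with integer coefficients, represented as normalised
-- differences of natural numbers: over an abstract ring the solver cannot
-- otherwise see that coefficients cancel.
module IntegerCoefficients (R : CommutativeRing 0ℓ 0ℓ) where
  open CommutativeRing R
  open SemiringMult semiring using (×-homo-+; ×1-homo-*) renaming (_×_ to _⋆_)
  open RingProperties ring using (-‿distribˡ-*; -‿distribʳ-*)
  open AbelianGroupProperties +-abelianGroup using (⁻¹-∙-comm; ⁻¹-anti-homo‿-; ε⁻¹≈ε)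
  open CommutativeSemigroupProperties +-commutativeSemigroup using (interchange)
  open SetoidReasoning setoid

  Coefficient : Set
  Coefficient = ℕ × ℕ

  private
    ι : ℕ → Carrier
    ι n = n ⋆ 1#

  -- The case split makes `0 , 0` and `1 , 0` denote `0#` and `1#` by computation, so that goals
  -- stated with `0#` and `1#` match the output of the solver without a spurious subtraction of
  -- zero.
  ⟦_⟧ : Coefficient → Carrier
  ⟦ m , ℕ.zero  ⟧ = ι m
  ⟦ m , ℕ.suc n ⟧ = ι m - ι (ℕ.suc n)

  ⟦⟧≈difference : ∀ m n → ⟦ m , n ⟧ ≈ ι m - ι n
  ⟦⟧≈difference m ℕ.zero    = sym (trans (+-congˡ ε⁻¹≈ε) (+-identityʳ _))
  ⟦⟧≈difference m (ℕ.suc n) = refl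

  shift : ∀ k m n → ι (k ℕ.+ m) - ι (k ℕ.+ n) ≈ ι m - ι n
  shift k m n = begin
    ι (k ℕ.+ m) - ι (k ℕ.+ n)             ≈⟨ +-cong (×-homo-+ 1# k m) (-‿cong (×-homo-+ 1# k n)) ⟩
    (ι k + ι m) - (ι k + ι n)         ≈⟨ +-congˡ (⁻¹-∙-comm (ι k) (ι n)) ⟨
    (ι k + ι m) + (- ι k + - ι n)     ≈⟨ interchange (ι k) (ι m) (- ι k) (- ι n) ⟩
    (ι k - ι k) + (ι m - ι n)         ≈⟨ +-congʳ (-‿inverseʳ (ι k)) ⟩
    0# + (ι m - ι n)                  ≈⟨ +-identityˡ _ ⟩
    ι m - ι n                         ∎

  normalise : ℕ → ℕ → Coefficient
  normalise m n = m ℕ.∸ n , n ℕ.∸ m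

  normalise-correct : ∀ m n → ⟦ normalise m n ⟧ ≈ ι m - ι n
  normalise-correct m n = trans (⟦⟧≈difference (m ℕ.∸ n) (n ℕ.∸ m)) (go m n)
    where
    go : ∀ m n → ι (m ℕ.∸ n) - ι (n ℕ.∸ m) ≈ ι m - ι n
    go ℕ.zero    ℕ.zero    = refl
    go ℕ.zero    (ℕ.suc n) = refl
    go (ℕ.suc m) ℕ.zero    = refl
    go (ℕ.suc m) (ℕ.suc n) = trans (go m n) (sym (shift 1 m n))

  coefficients : RawRing 0ℓ 0ℓ
  coefficients = record
    { Carrier = Coefficient
    ; _≈_     = _≡_
    ; _+_     = λ { (a , b) (c , d) → normalise (a ℕ.+ c) (b ℕ.+ d) }
    ; _*_     = λ { (a , b) (c , d) → normalise (a ℕ.* c ℕ.+ b ℕ.* d) (a ℕ.* d ℕ.+ b ℕ.* c) }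
    ; -_      = λ { (a , b) → b , a }
    ; 0#      = 0 , 0
    ; 1#      = 1 , 0
    }

  private
    module C = RawRing coefficients

  +-homo : ∀ p q → ⟦ p C.+ q ⟧ ≈ ⟦ p ⟧ + ⟦ q ⟧
  +-homo (a , b) (c , d) = begin
    ⟦ normalise (a ℕ.+ c) (b ℕ.+ d) ⟧          ≈⟨ normalise-correct (a ℕ.+ c) (b ℕ.+ d) ⟩
    ι (a ℕ.+ c) - ι (b ℕ.+ d)                  ≈⟨ +-cong (×-homo-+ 1# a c) (-‿cong (×-homo-+ 1# b d)) ⟩
    (ι a + ι c) - (ι b + ι d)              ≈⟨ +-congˡ (⁻¹-∙-comm (ι b) (ι d)) ⟨
    (ι a + ι c) + (- ι b + - ι d)          ≈⟨ interchange (ι a) (ι c) (- ι b) (- ι d) ⟩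
    (ι a - ι b) + (ι c - ι d)              ≈⟨ +-cong (⟦⟧≈difference a b) (⟦⟧≈difference c d) ⟨
    ⟦ a , b ⟧ + ⟦ c , d ⟧                  ∎

  *-homo : ∀ p q → ⟦ p C.* q ⟧ ≈ ⟦ p ⟧ * ⟦ q ⟧
  *-homo (a , b) (c , d) = begin
    ⟦ normalise (a ℕ.* c ℕ.+ b ℕ.* d) (a ℕ.* d ℕ.+ b ℕ.* c) ⟧
      ≈⟨ normalise-correct (a ℕ.* c ℕ.+ b ℕ.* d) (a ℕ.* d ℕ.+ b ℕ.* c) ⟩
    ι (a ℕ.* c ℕ.+ b ℕ.* d) - ι (a ℕ.* d ℕ.+ b ℕ.* c)
      ≈⟨ +-cong (ι-dot a c b d) (-‿cong (ι-dot a d b c)) ⟩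
    (ι a * ι c + ι b * ι d) - (ι a * ι d + ι b * ι c)
      ≈⟨ +-congˡ (trans (-‿cong (+-comm _ _)) (sym (⁻¹-∙-comm _ _))) ⟩
    (ι a * ι c + ι b * ι d) + (- (ι b * ι c) + - (ι a * ι d))
      ≈⟨ interchange (ι a * ι c) (ι b * ι d) (- (ι b * ι c)) (- (ι a * ι d)) ⟩
    (ι a * ι c + - (ι b * ι c)) + (ι b * ι d + - (ι a * ι d))
      ≈⟨ +-cong (right-diff (ι a) (ι b) (ι c)) (cross-diff (ι a) (ι b) (ι d)) ⟨
    (ι a - ι b) * ι c + (ι a - ι b) * - ι d
      ≈⟨ distribˡ _ _ _ ⟨
    (ι a - ι b) * (ι c - ι d)
      ≈⟨ *-cong (⟦⟧≈difference a b) (⟦⟧≈difference c d) ⟨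
    ⟦ a , b ⟧ * ⟦ c , d ⟧ ∎
    where
    ι-dot : ∀ a c b d → ι (a ℕ.* c ℕ.+ b ℕ.* d) ≈ ι a * ι c + ι b * ι d
    ι-dot a c b d = trans (×-homo-+ 1# (a ℕ.* c) (b ℕ.* d)) (+-cong (×1-homo-* a c) (×1-homo-* b d))
    right-diff : ∀ x y z → (x - y) * z ≈ x * z + - (y * z)
    right-diff x y z = trans (distribʳ z x (- y)) (+-congˡ (sym (-‿distribˡ-* y z)))
    cross-diff : ∀ x y z → (x - y) * - z ≈ y * z + - (x * z)
    cross-diff x y z = trans (trans (sym (-‿distribʳ-* _ _)) (-‿distribˡ-* _ _))
      (trans (*-congʳ (⁻¹-anti-homo‿- x y)) (right-diff y x z))

  homomorphism : coefficients -Raw-AlmostCommutative⟶ fromCommutativeRing R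
  homomorphism = record
    { ⟦_⟧    = ⟦_⟧
    ; +-homo = +-homo
    ; *-homo = *-homo
    ; -‿homo = λ { (a , b) → trans (⟦⟧≈difference b a)
                    (sym (trans (-‿cong (⟦⟧≈difference a b)) (⁻¹-anti-homo‿- (ι a) (ι b)))) }
    ; 0-homo = refl
    ; 1-homo = refl
    }

  _≟_ : ∀ p q → Maybe (⟦ p ⟧ ≈ ⟦ q ⟧)
  p ≟ q = Maybe.map (λ { ≡.refl → refl }) (dec⇒weaklyDec (≡-dec ℕ._≟_ ℕ._≟_) p q)

  open RingSolver coefficients (fromCommutativeRing R) homomorphism _≟_ public
    using (solve; _:=_; _:+_; _:*_; _:-_; :-_; con)

-- Arithmetic and order in an ordered field.

module OrderedField (𝓡 : RealField) where
  open RealField 𝓡 public hiding (zero) renaming (trans to ≈-trans; sym to ≈-sym; refl to ≈-refl)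
  open IsStrictTotalOrder isStrictTotalOrder public
    using (compare; irrefl; <-resp-≈; <-respˡ-≈; <-respʳ-≈; isStrictPartialOrder; _≟_)
    renaming (trans to <-trans)
  open GroupProperties +-group public using ()
    renaming (inverseˡ-unique to +-inverseˡ-unique; x∙y⁻¹≈ε⇒x≈y to x-y≈0⇒x≈y; x≈y⇒x∙y⁻¹≈ε to x≈y⇒x-y≈0)
  open IntegerCoefficients commutativeRing public
    using (solve; _:=_; _:+_; _:*_; _:-_; :-_; con)

  x<y⇒0<y-x : ∀ {x y} → x < y → 0# < y - x
  x<y⇒0<y-x {x} x<y = <-respˡ-≈ (-‿inverseʳ x) (+-mono-< (- x) x<y)

  0<y-x⇒x<y : ∀ {x y} → 0# < y - x → x < y
  0<y-x⇒x<y {x} {y} 0<y-x = <-respˡ-≈ (+-identityˡ x)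
    (<-respʳ-≈ (solve 2 (λ x y → (y :- x) :+ x := y) ≈-refl x y) (+-mono-< x 0<y-x))

  +-pos : ∀ {x y} → 0# < x → 0# < y → 0# < x + y
  +-pos {x} {y} 0<x 0<y = <-trans 0<y (<-respˡ-≈ (+-identityˡ y) (+-mono-< y 0<x))

  ≤-trans : ∀ {x y z} → x ≤ y → y ≤ z → x ≤ z
  ≤-trans = StrictToNonStrict.trans _≈_ _<_ isEquivalence <-resp-≈ <-trans

  <-≤-trans : ∀ {x y z} → x < y → y ≤ z → x < z
  <-≤-trans = StrictToNonStrict.<-≤-trans _≈_ _<_ <-trans <-respʳ-≈

  ≤-<-trans : ∀ {x y z} → x ≤ y → y < z → x < z
  ≤-<-trans = StrictToNonStrict.≤-<-trans _≈_ _<_ ≈-sym <-trans <-respˡ-≈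

  ≤-antisym : ∀ {x y} → x ≤ y → y ≤ x → x ≈ y
  ≤-antisym = StrictToNonStrict.antisym _≈_ _<_ isEquivalence <-trans irrefl

  ≤-respˡ-≈ : ∀ {x y z} → x ≈ y → x ≤ z → y ≤ z
  ≤-respˡ-≈ = StrictToNonStrict.≤-respˡ-≈ _≈_ _<_ ≈-sym ≈-trans <-respˡ-≈

  ≤-respʳ-≈ : ∀ {x y z} → y ≈ z → x ≤ y → x ≤ z
  ≤-respʳ-≈ = StrictToNonStrict.≤-respʳ-≈ _≈_ _<_ ≈-trans <-respʳ-≈

  +-nonneg : ∀ {x y} → 0# ≤ x → 0# ≤ y → 0# ≤ x + y
  +-nonneg (inj₁ 0<x) (inj₁ 0<y) = inj₁ (+-pos 0<x 0<y)
  +-nonneg {x} (inj₁ 0<x) (inj₂ 0≈y) = inj₁ (<-respʳ-≈ (≈-trans (≈-sym (+-identityʳ x)) (+-congˡ 0≈y)) 0<x)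
  +-nonneg {x} {y} (inj₂ 0≈x) 0≤y = ≤-respʳ-≈ (≈-trans (≈-sym (+-identityˡ y)) (+-congʳ 0≈x)) 0≤y

  *-nonneg : ∀ {x y} → 0# ≤ x → 0# ≤ y → 0# ≤ x * y
  *-nonneg (inj₁ 0<x) (inj₁ 0<y) = inj₁ (*-pos 0<x 0<y)
  *-nonneg {x} (inj₁ _) (inj₂ 0≈y) = inj₂ (≈-trans (≈-sym (zeroʳ x)) (*-congˡ 0≈y))
  *-nonneg {x} {y} (inj₂ 0≈x) _ = inj₂ (≈-trans (≈-sym (zeroˡ y)) (*-congʳ 0≈x))

  x≤y⇒0≤y-x : ∀ {x y} → x ≤ y → 0# ≤ y - x
  x≤y⇒0≤y-x (inj₁ x<y) = inj₁ (x<y⇒0<y-x x<y)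
  x≤y⇒0≤y-x (inj₂ x≈y) = inj₂ (≈-sym (x≈y⇒x-y≈0 (≈-sym x≈y)))

  0≤y-x⇒x≤y : ∀ {x y} → 0# ≤ y - x → x ≤ y
  0≤y-x⇒x≤y (inj₁ p) = inj₁ (0<y-x⇒x<y p)
  0≤y-x⇒x≤y {x} {y} (inj₂ p) = inj₂ (≈-sym (x-y≈0⇒x≈y y x (≈-sym p)))

  *-mono-≤ : ∀ {a b c d} → 0# ≤ a → a ≤ b → 0# ≤ c → c ≤ d → a * c ≤ b * d
  *-mono-≤ {a} {b} {c} {d} 0≤a a≤b 0≤c c≤d = 0≤y-x⇒x≤y (≤-respʳ-≈
    (solve 4 (λ a b c d → (b :- a) :* d :+ a :* (d :- c) := b :* d :- a :* c) ≈-refl a b c d)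
    (+-nonneg (*-nonneg (x≤y⇒0≤y-x a≤b) (≤-trans 0≤c c≤d)) (*-nonneg 0≤a (x≤y⇒0≤y-x c≤d))))

  +-mono-≤ : ∀ {a b c d} → a ≤ b → c ≤ d → a + c ≤ b + d
  +-mono-≤ {a} {b} {c} {d} a≤b c≤d = 0≤y-x⇒x≤y (≤-respʳ-≈
    (solve 4 (λ a b c d → (b :- a) :+ (d :- c) := (b :+ d) :- (a :+ c)) ≈-refl a b c d)
    (+-nonneg (x≤y⇒0≤y-x a≤b) (x≤y⇒0≤y-x c≤d)))

  0<⇒≉0 : ∀ {x} → 0# < x → ¬ x ≈ 0#
  0<⇒≉0 0<x x≈0 = irrefl (≈-sym x≈0) 0<x

  neg-pos : ∀ {x} → x < 0# → 0# < - x
  neg-pos {x} x<0 = <-respʳ-≈ (+-identityˡ (- x)) (x<y⇒0<y-x x<0)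

  x≉0⇒0<x*x : ∀ {x} → ¬ x ≈ 0# → 0# < x * x
  x≉0⇒0<x*x {x} x≉0 with compare x 0#
  ... | tri< x<0 _ _ = <-respʳ-≈ (solve 1 (λ x → :- x :* :- x := x :* x)
                  ≈-refl x) (*-pos (neg-pos x<0) (neg-pos x<0))
  ... | tri≈ _ x≈0 _ = contradiction x≈0 x≉0
  ... | tri> _ _ 0<x = *-pos 0<x 0<x

  0≤x*x : ∀ x → 0# ≤ x * x
  0≤x*x x with x ≟ 0#
  ... | yes x≈0 = inj₂ (≈-sym (≈-trans (*-congˡ x≈0) (zeroʳ x)))
  ... | no  x≉0 = inj₁ (x≉0⇒0<x*x x≉0)

  x*x≈0⇒x≈0 : ∀ {x} → x * x ≈ 0# → x ≈ 0#
  x*x≈0⇒x≈0 {x} xx≈0 with x ≟ 0#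
  ... | yes x≈0 = x≈0
  ... | no  x≉0 = contradiction xx≈0 (0<⇒≉0 (x≉0⇒0<x*x x≉0))

  x*y≈0⇒x≈0⊎y≈0 : ∀ x y → x * y ≈ 0# → x ≈ 0# ⊎ y ≈ 0#
  x*y≈0⇒x≈0⊎y≈0 x y xy≈0 with x ≟ 0#
  ... | yes x≈0 = inj₁ x≈0
  ... | no  x≉0 = inj₂ (x*x≈0⇒x≈0 (case (inverse x x≉0)))
    where
    case : (∃[ z ] x * z ≈ 1#) → y * y ≈ 0#
    case (z , xz≈1) = ≈-trans (≈-sym (*-identityˡ (y * y))) (≈-trans (*-congʳ (≈-sym xz≈1))
      (≈-trans (solve 3 (λ x y z → x :* z :* (y :* y) := x :* y :* (z :* y)) ≈-refl x y z)
      (≈-trans (*-congʳ xy≈0) (zeroˡ (z * y)))))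

  *-cancelˡ-≉0 : ∀ {x y} → ¬ x ≈ 0# → x * y ≈ 0# → y ≈ 0#
  *-cancelˡ-≉0 {x} {y} x≉0 xy≈0 with x*y≈0⇒x≈0⊎y≈0 x y xy≈0
  ... | inj₁ x≈0 = contradiction x≈0 x≉0
  ... | inj₂ y≈0 = y≈0

  sumOfSquares≈0 : ∀ {x y} → x * x + y * y ≈ 0# → x ≈ 0# × y ≈ 0#
  sumOfSquares≈0 {x} {y} h with x ≟ 0# | y ≟ 0#
  ... | yes x≈0 | yes y≈0 = x≈0 , y≈0
  ... | no x≉0 | _ = contradiction h (0<⇒≉0 (<-≤-trans (x≉0⇒0<x*x x≉0)
        (0≤y-x⇒x≤y (≤-respʳ-≈ (solve 2 (λ x y → y :* y := (x :* x :+ y :* y) :- x :* x)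
                        ≈-refl x y) (0≤x*x y)))))
  ... | yes _ | no y≉0 = contradiction h (0<⇒≉0 (<-≤-trans (x≉0⇒0<x*x y≉0)
        (0≤y-x⇒x≤y (≤-respʳ-≈ (solve 2 (λ x y → x :* x := (x :* x :+ y :* y) :- y :* y)
                        ≈-refl x y) (0≤x*x x)))))

  -- The inverse is positive because it equals `x * (y * y)`, a product of positive factors.
  posInverse : ∀ {x} → 0# < x → ∃[ y ] 0# < y × x * y ≈ 1#
  posInverse {x} 0<x = pos (inverse x (0<⇒≉0 0<x))
    where
    pos : (∃[ y ] x * y ≈ 1#) → ∃[ y ] 0# < y × x * y ≈ 1#
    pos (y , xy≈1) = y , <-respʳ-≈ xyy≈y (*-pos 0<x (x≉0⇒0<x*x y≉0)) , xy≈1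
      where
      y≉0 : ¬ y ≈ 0#
      y≉0 y≈0 = irrefl (≈-trans (≈-sym (≈-trans (*-congˡ y≈0) (zeroʳ x))) xy≈1) 0<1
      xyy≈y : x * (y * y) ≈ y
      xyy≈y = ≈-trans (≈-sym (*-assoc x y y)) (≈-trans (*-congʳ xy≈1) (*-identityˡ y))

-- Plane vectors: directions, parallelism, and unit vectors with sum zero.

module PlaneVectors (𝓡 : RealField) where
  open OrderedField 𝓡
  open Plane 𝓡

  private variable
    A B C D P Q R U V W : Point

  0ₚ : Point
  0ₚ = 0# , 0#

  infix 8 -ₚ_
  -ₚ_ : Point → Point
  -ₚ (x , y) = - x , - y

  infixl 7 _∙_ _∧_
  _∙_ _∧_ : Point → Point → Carrier
  (x , y) ∙ (x′ , y′) = x * x′ + y * y′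
  (x , y) ∧ (x′ , y′) = x * y′ - y * x′

  ≈ₚ-sym : P ≈ₚ Q → Q ≈ₚ P
  ≈ₚ-sym (p , q) = ≈-sym p , ≈-sym q

  ≈ₚ-trans : P ≈ₚ Q → Q ≈ₚ R → P ≈ₚ R
  ≈ₚ-trans (p , q) (p′ , q′) = ≈-trans p p′ , ≈-trans q q′

  ≈ₚ-reflexive : P ≡ Q → P ≈ₚ Q
  ≈ₚ-reflexive ≡.refl = ≈-refl , ≈-refl

  ∙-cong : A ≈ₚ B → C ≈ₚ D → A ∙ C ≈ B ∙ D
  ∙-cong (p , q) (r , s) = +-cong (*-cong p r) (*-cong q s)

  ∧-cong : A ≈ₚ B → C ≈ₚ D → A ∧ C ≈ B ∧ D
  ∧-cong (p , q) (r , s) = +-cong (*-cong p s) (-‿cong (*-cong q r))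

  ∧-self : ∀ U → U ∧ U ≈ 0#
  ∧-self (u , u′) = solve 2 (λ u u′ → u :* u′ :- u′ :* u := con (0 , 0)) ≈-refl u u′

  ∙-distribˡ-- : ∀ U V W → U ∙ (V -ₚ W) ≈ U ∙ V - U ∙ W
  ∙-distribˡ-- (u , u′) (v , v′) (w , w′) = solve 6 (λ u u′ v v′ w w′ →
    u :* (v :- w) :+ u′ :* (v′ :- w′) := (u :* v :+ u′ :* v′) :- (u :* w :+ u′ :* w′)) ≈-refl u u′ v v′ w w′

  infix 4 _∥⁺_
  -- Equality of direction without normalising to length one. It is an equivalence relation, and
  -- straightness, rays and lines of sight are all expressed by it.
  _∥⁺_ : Point → Point → Set
  U ∥⁺ V = ∃[ t ] 0# < t × U ≈ₚ t · V

  ∥⁺-refl : U ∥⁺ U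
  ∥⁺-refl = 1# , 0<1 , ≈-sym (*-identityˡ _) , ≈-sym (*-identityˡ _)

  unscale : ∀ {t u v} s → t * s ≈ 1# → u ≈ t * v → v ≈ s * u
  unscale {t} {u} {v} s ts≈1 u≈tv = ≈-sym (≈-trans (*-congˡ u≈tv) (≈-trans
    (solve 3 (λ s t v → s :* (t :* v) := t :* s :* v) ≈-refl s t v)
    (≈-trans (*-congʳ ts≈1) (*-identityˡ v))))

  ∥⁺-sym : U ∥⁺ V → V ∥⁺ U
  ∥⁺-sym {u , u′} {v , v′} (t , 0<t , p , p′) = invert (posInverse 0<t)
    where
    invert : (∃[ s ] 0# < s × t * s ≈ 1#) → (v , v′) ∥⁺ (u , u′)
    invert (s , 0<s , ts≈1) = s , 0<s , unscale s ts≈1 p , unscale s ts≈1 p′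

  infix 4 _≼_
  -- For displacements from a common point: the end of `U` lies on the segment traced by `V`.
  _≼_ : Point → Point → Set
  U ≼ V = ∃[ t ] 0# ≤ t × t ≤ 1# × U ≈ₚ t · V

  ∥⁺⇒≼ : U ∥⁺ V → U ≼ V ⊎ V ≼ U
  ∥⁺⇒≼ {u , u′} {v , v′} (t , 0<t , p , p′) = case compare t 1# of λ where
      (tri< t<1 _ _) → inj₁ (t , inj₁ 0<t , inj₁ t<1 , p , p′)
      (tri≈ _ t≈1 _) → inj₁ (t , inj₁ 0<t , inj₂ t≈1 , p , p′)
      (tri> _ _ 1<t) → inj₂ (invert 1<t (posInverse 0<t))
    where
    invert : 1# < t → (∃[ s ] 0# < s × t * s ≈ 1#) → (v , v′) ≼ (u , u′)
    invert 1<t (s , 0<s , ts≈1) = s , inj₁ 0<s , inj₁ s<1 , unscale s ts≈1 p , unscale s ts≈1 p′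
      where
      s<1 : s < 1#
      s<1 = 0<y-x⇒x<y (<-respʳ-≈ (≈-trans (solve 2 (λ s t → (t :- con (1 , 0)) :* s := t :* s :- s)
                      ≈-refl s t)
              (+-congʳ ts≈1)) (*-pos (x<y⇒0<y-x 1<t) 0<s))

  ∥⁺-trans : U ∥⁺ V → V ∥⁺ W → U ∥⁺ W
  ∥⁺-trans (t , 0<t , p , p′) (s , 0<s , q , q′) = t * s , *-pos 0<t 0<s , scale p q , scale p′ q′
    where
    scale : ∀ {u v w} → u ≈ t * v → v ≈ s * w → u ≈ t * s * w
    scale p q = ≈-trans p (≈-trans (*-congˡ q) (≈-sym (*-assoc t s _)))

  ≈ₚ⇒∥⁺ : U ≈ₚ V → U ∥⁺ V
  ≈ₚ⇒∥⁺ (p , q) = 1# , 0<1 , ≈-trans p (≈-sym (*-identityˡ _)) , ≈-trans q (≈-sym (*-identityˡ _))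

  ∥⁺-neg : U ∥⁺ V → -ₚ U ∥⁺ -ₚ V
  ∥⁺-neg (t , 0<t , p , p′) = t , 0<t , neg p , neg p′
    where
    neg : ∀ {u v} → u ≈ t * v → - u ≈ t * - v
    neg {u} {v} p = ≈-trans (-‿cong p) (solve 2 (λ t v → :- (t :* v) := t :* :- v) ≈-refl t v)

  ∥⁺-add : U ∥⁺ W → V ∥⁺ W → U +ₚ V ∥⁺ W
  ∥⁺-add (t , 0<t , p , p′) (s , 0<s , q , q′) = t + s , +-pos 0<t 0<s , add p q , add p′ q′
    where
    add : ∀ {u v w} → u ≈ t * w → v ≈ s * w → u + v ≈ (t + s) * w
    add p q = ≈-trans (+-cong p q) (≈-sym (distribʳ _ t s))

  -ₚ-flip : P -ₚ Q ≈ₚ -ₚ (Q -ₚ P)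
  -ₚ-flip {p , p′} {q , q′} = flip p q , flip p′ q′
    where
    flip : ∀ p q → p - q ≈ - (q - p)
    flip = solve 2 (λ p q → p :- q := :- (q :- p)) ≈-refl

  ∥⁺-flip : P -ₚ Q ∥⁺ A -ₚ B → Q -ₚ P ∥⁺ B -ₚ A
  ∥⁺-flip h = ∥⁺-trans (≈ₚ⇒∥⁺ -ₚ-flip) (∥⁺-trans (∥⁺-neg h) (∥⁺-sym (≈ₚ⇒∥⁺ -ₚ-flip)))

  ∥⁺-chain : P -ₚ Q ∥⁺ W → Q -ₚ R ∥⁺ W → P -ₚ R ∥⁺ W
  ∥⁺-chain {p , p′} {q , q′} {R = r , r′} h k =
    ∥⁺-trans (≈ₚ⇒∥⁺ (telescope p q r , telescope p′ q′ r′)) (∥⁺-add h k)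
    where
    telescope : ∀ p q r → p - r ≈ (p - q) + (q - r)
    telescope = solve 3 (λ p q r → p :- r := (p :- q) :+ (q :- r)) ≈-refl

  P-Q≈0⇒P≈Q : P -ₚ Q ≈ₚ 0ₚ → P ≈ₚ Q
  P-Q≈0⇒P≈Q (p , q) = x-y≈0⇒x≈y _ _ p , x-y≈0⇒x≈y _ _ q

  ∥⁺-≉0 : U ∥⁺ V → ¬ V ≈ₚ 0ₚ → ¬ U ≈ₚ 0ₚ
  ∥⁺-≉0 (t , 0<t , p , p′) V≉0 (u≈0 , u′≈0) = V≉0
    (*-cancelˡ-≉0 (0<⇒≉0 0<t) (≈-trans (≈-sym p) u≈0) , *-cancelˡ-≉0 (0<⇒≉0 0<t) (≈-trans (≈-sym p′) u′≈0))

  ∥⁺-irrefl-neg : U ∥⁺ -ₚ U → U ≈ₚ 0ₚ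
  ∥⁺-irrefl-neg {u , u′} (t , 0<t , p , p′) = vanish p , vanish p′
    where
    vanish : ∀ {u} → u ≈ t * - u → u ≈ 0#
    vanish {u} h = *-cancelˡ-≉0 (0<⇒≉0 (+-pos 0<t 0<1)) (≈-trans
      (solve 2 (λ t u → (t :+ con (1 , 0)) :* u := u :- t :* :- u) ≈-refl t u) (x≈y⇒x-y≈0 h))

  ∙-self-pos : ¬ U ≈ₚ 0ₚ → 0# < U ∙ U
  ∙-self-pos {u , u′} U≉0 with compare 0# ((u , u′) ∙ (u , u′))
  ... | tri< 0<UU _ _ = 0<UU
  ... | tri≈ _ 0≈UU _ = contradiction (sumOfSquares≈0 (≈-sym 0≈UU)) U≉0
  ... | tri> ¬0<UU ¬0≈UU _ with +-nonneg (0≤x*x u) (0≤x*x u′)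
  ...   | inj₁ 0<UU = contradiction 0<UU ¬0<UU
  ...   | inj₂ 0≈UU = contradiction 0≈UU ¬0≈UU

  ∙-∥⁺-pos : ¬ V ≈ₚ 0ₚ → U ∥⁺ V → 0# < V ∙ U
  ∙-∥⁺-pos {v , v′} {U} V≉0 (t , 0<t , p) = <-respʳ-≈ (≈-sym (≈-trans (∙-cong (≈-refl , ≈-refl) p)
    (solve 3 (λ t v v′ → v :* (t :* v) :+ v′ :* (t :* v′) := t :* (v :* v :+ v′ :* v′)) ≈-refl t v v′)))
    (*-pos 0<t (∙-self-pos V≉0))

  ∧-∥⁺-≉0 : U ∥⁺ A → V ∥⁺ B → ¬ A ∧ B ≈ 0# → ¬ U ∧ V ≈ 0#
  ∧-∥⁺-≉0 {A = a , a′} {B = b , b′} (t , 0<t , p) (s , 0<s , q) A∧B≉0 U∧V≈0 = A∧B≉0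
    (*-cancelˡ-≉0 (0<⇒≉0 (*-pos 0<t 0<s)) (≈-trans
      (solve 6 (λ t s a a′ b b′ → t :* s :* (a :* b′ :- a′ :* b)
           := (t :* a) :* (s :* b′) :- (t :* a′) :* (s :* b))
           ≈-refl t s a a′ b b′)
      (≈-trans (≈-sym (∧-cong p q)) U∧V≈0)))

  -- A point is fixed by its directions from two stations. With ratios `t` and `s`, `P - Q` is both
  -- `(t - 1)(Q - A)` and `(s - 1)(Q - B)`; taking `∧` with `Q - B` leaves `t - 1` times a nonzero
  -- factor, so `t ≈ 1`.
  triangulate : P -ₚ A ∥⁺ Q -ₚ A → P -ₚ B ∥⁺ Q -ₚ B → ¬ (Q -ₚ A) ∧ (Q -ₚ B) ≈ 0# → P ≈ₚ Q
  triangulate {p , p′} {a , a′} {q , q′} {b , b′} (t , _ , h , h′) (s , _ , k , k′) nc =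
    at h , at h′
    where
    ta≈sb : ∀ {p a q b} → p - a ≈ t * (q - a) → p - b ≈ s * (q - b) → (t - 1#) * (q - a) ≈ (s - 1#) * (q - b)
    ta≈sb {p} {a} {q} {b} h k = ≈-trans (expand t q a) (≈-trans (+-congʳ (≈-sym h))
      (≈-trans (solve 4 (λ p a q b → (p :- a) :- (q :- a) := (p :- b) :- (q :- b)) ≈-refl p a q b)
      (≈-trans (+-congʳ k) (≈-sym (expand s q b)))))
      where
      expand : ∀ t q a → (t - 1#) * (q - a) ≈ t * (q - a) - (q - a)
      expand = solve 3 (λ t q a → (t :- con (1 , 0)) :* (q :- a) := t :* (q :- a) :- (q :- a)) ≈-refl
    t≈1 : t ≈ 1#
    t≈1 = x-y≈0⇒x≈y t 1# (*-cancelˡ-≉0 nc (begin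
      ((q - a) * (q′ - b′) - (q′ - a′) * (q - b)) * (t - 1#)
        ≈⟨ solve 5 (λ A A′ B B′ T → (A :* B′ :- A′ :* B) :* T := (T :* A) :* B′ :- (T :* A′) :* B)
               ≈-refl (q - a) (q′ - a′) (q - b) (q′ - b′) (t - 1#) ⟩
      ((t - 1#) * (q - a)) * (q′ - b′) - ((t - 1#) * (q′ - a′)) * (q - b)
        ≈⟨ +-cong (*-congʳ (ta≈sb h k)) (-‿cong (*-congʳ (ta≈sb h′ k′))) ⟩
      ((s - 1#) * (q - b)) * (q′ - b′) - ((s - 1#) * (q′ - b′)) * (q - b)
        ≈⟨ solve 3 (λ B B′ S → (S :* B) :* B′ :- (S :* B′) :* B := con (0 , 0))
               ≈-refl (q - b) (q′ - b′) (s - 1#) ⟩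
      0# ∎))
      where open SetoidReasoning setoid
    at : ∀ {p a q} → p - a ≈ t * (q - a) → p ≈ q
    at {p} {a} {q} h = x-y≈0⇒x≈y p q (≈-trans (solve 3 (λ p a q → p :- q := (p :- a) :- (q :- a))
                    ≈-refl p a q)
      (x≈y⇒x-y≈0 (≈-trans h (≈-trans (*-congʳ t≈1) (*-identityˡ (q - a))))))

  x+x≈0⇒x≈0 : ∀ {x} → x + x ≈ 0# → x ≈ 0#
  x+x≈0⇒x≈0 {x} h = *-cancelˡ-≉0 (0<⇒≉0 (+-pos 0<1 0<1))
    (≈-trans (solve 1 (λ x → (con (1 , 0) :+ con (1 , 0)) :* x := x :+ x) ≈-refl x) h)

  -- (A + B) ∙ (A + C) = B ∙ C - A ∙ D, and both dot products are determined
  -- by ∥ B + C ∥² = ∥ A + D ∥².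
  diagonals-orthogonal : ∥ A ∥² ≈ 1# → ∥ B ∥² ≈ 1# → ∥ C ∥² ≈ 1# → ∥ D ∥² ≈ 1# →
    A +ₚ (B +ₚ (C +ₚ D)) ≈ₚ 0ₚ → (A +ₚ B) ∙ (A +ₚ C) ≈ 0#
  diagonals-orthogonal {a , a′} {b , b′} {c , c′} {d , d′} nA nB nC nD (h , h′) =
    x+x≈0⇒x≈0 (begin
      _ ≈⟨ solve 8 (λ a a′ b b′ c c′ d d′ →
             let s  = a :+ (b :+ (c :+ d)) ; s′ = a′ :+ (b′ :+ (c′ :+ d′))
                 x  = (a :+ b) :* (a :+ c) :+ (a′ :+ b′) :* (a′ :+ c′)
             in x :+ x := (s :* (a :+ b :+ c :- d) :+ s′ :* (a′ :+ b′ :+ c′ :- d′))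
                  :+ ((a :* a :+ a′ :* a′) :- (b :* b :+ b′ :* b′)) :+ ((d :* d :+ d′ :* d′) :- (c :* c :+ c′ :* c′)))
           ≈-refl a a′ b b′ c c′ d d′ ⟩
      _ ≈⟨ +-cong (+-cong (+-cong (≈-trans (*-congʳ h) (zeroˡ _)) (≈-trans (*-congʳ h′) (zeroˡ _)))
             (x≈y⇒x-y≈0 (≈-trans nA (≈-sym nB)))) (x≈y⇒x-y≈0 (≈-trans nD (≈-sym nC))) ⟩
      ((0# + 0#) + 0#) + 0# ≈⟨ solve 0 (((con (0 , 0) :+ con (0 , 0)) :+ con (0 , 0)) :+ con (0 , 0) := con (0 , 0)) ≈-refl ⟩
      0# ∎)
    where open SetoidReasoning setoid

  -- ∥ U ∥² ∥ V ∥² = (U ∙ V)² + (U ∧ V)²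
  orthogonal-parallel : U ∙ V ≈ 0# → U ∧ V ≈ 0# → U ≈ₚ 0ₚ ⊎ V ≈ₚ 0ₚ
  orthogonal-parallel {u , u′} {v , v′} U∙V≈0 U∧V≈0 = Sum.map sumOfSquares≈0 sumOfSquares≈0
    (x*y≈0⇒x≈0⊎y≈0 (u * u + u′ * u′) (v * v + v′ * v′) (begin
      _ ≈⟨ solve 4 (λ u u′ v v′ → let dot = u :* v :+ u′ :* v′ ; cross = u :* v′ :- u′ :* v
             in (u :* u :+ u′ :* u′) :* (v :* v :+ v′ :* v′) := dot :* dot :+ cross :* cross) ≈-refl u u′ v v′ ⟩
      _ ≈⟨ +-cong (≈-trans (*-congʳ U∙V≈0) (zeroˡ _)) (≈-trans (*-congʳ U∧V≈0) (zeroˡ _)) ⟩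
      0# + 0# ≈⟨ +-identityˡ 0# ⟩
      0# ∎))
    where open SetoidReasoning setoid

  -- ∥ U ∥² (V ∙ W) = (U ∙ V) (U ∙ W) + (U ∧ V) (U ∧ W)
  orthogonal-triple : U ∙ V ≈ 0# → U ∙ W ≈ 0# → V ∙ W ≈ 0# → U ≈ₚ 0ₚ ⊎ (V ≈ₚ 0ₚ ⊎ W ≈ₚ 0ₚ)
  orthogonal-triple {u , u′} {v , v′} {w , w′} UV UW VW =
    [ (λ U∧V≈0 → Sum.map₂ inj₁ (orthogonal-parallel UV U∧V≈0))
    , (λ U∧W≈0 → Sum.map₂ inj₂ (orthogonal-parallel UW U∧W≈0)) ]′
    (x*y≈0⇒x≈0⊎y≈0 (u * v′ - u′ * v) (u * w′ - u′ * w) (begin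
      _ ≈⟨ solve 6 (λ u u′ v v′ w w′ → (u :* v′ :- u′ :* v) :* (u :* w′ :- u′ :* w)
             := (u :* u :+ u′ :* u′) :* (v :* w :+ v′ :* w′) :- (u :* v :+ u′ :* v′) :* (u :* w :+ u′ :* w′))
             ≈-refl u u′ v v′ w w′ ⟩
      _ ≈⟨ +-cong (≈-trans (*-congˡ VW) (zeroʳ _)) (-‿cong (≈-trans (*-congʳ UV) (zeroˡ _))) ⟩
      0# - 0# ≈⟨ -‿inverseʳ 0# ⟩
      0# ∎))
    where open SetoidReasoning setoid

  -- The vectors `A + B`, `A + C` and `A + D` are pairwise orthogonal, by `diagonals-orthogonal` in
  -- three orders. The plane has no room for three nonzero such vectors, so one of them vanishes,
  -- and the complementary pair then has sum zero too.
  rhombus : ∥ A ∥² ≈ 1# → ∥ B ∥² ≈ 1# → ∥ C ∥² ≈ 1# → ∥ D ∥² ≈ 1# → A +ₚ (B +ₚ (C +ₚ D)) ≈ₚ 0ₚ →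
    (A +ₚ B ≈ₚ 0ₚ × C +ₚ D ≈ₚ 0ₚ) ⊎ ((A +ₚ C ≈ₚ 0ₚ × B +ₚ D ≈ₚ 0ₚ) ⊎ (A +ₚ D ≈ₚ 0ₚ × B +ₚ C ≈ₚ 0ₚ))
  rhombus {a , a′} {b , b′} {c , c′} {d , d′} nA nB nC nD (h , h′) =
    Sum.map (complete₂ (regroup₂ a b c d) (regroup₂ a′ b′ c′ d′))
      (Sum.map (complete₂ (regroup₃ a b c d) (regroup₃ a′ b′ c′ d′))
        (complete₂ (regroup₄ a b c d) (regroup₄ a′ b′ c′ d′)))
      (orthogonal-triple
        (diagonals-orthogonal nA nB nC nD (h , h′))
        (diagonals-orthogonal nA nB nD nC (≈-trans (swap a b c d) h , ≈-trans (swap a′ b′ c′ d′) h′))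
        (diagonals-orthogonal nA nC nD nB (≈-trans (rotate a b c d) h , ≈-trans (rotate a′ b′ c′ d′) h′)))
    where
    swap : ∀ a b c d → a + (b + (d + c)) ≈ a + (b + (c + d))
    swap = solve 4 (λ a b c d → a :+ (b :+ (d :+ c)) := a :+ (b :+ (c :+ d))) ≈-refl
    rotate : ∀ a b c d → a + (c + (d + b)) ≈ a + (b + (c + d))
    rotate = solve 4 (λ a b c d → a :+ (c :+ (d :+ b)) := a :+ (b :+ (c :+ d))) ≈-refl
    regroup₂ : ∀ a b c d → a + (b + (c + d)) ≈ (a + b) + (c + d)
    regroup₂ = solve 4 (λ a b c d → a :+ (b :+ (c :+ d)) := (a :+ b) :+ (c :+ d)) ≈-refl
    regroup₃ : ∀ a b c d → a + (b + (c + d)) ≈ (a + c) + (b + d)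
    regroup₃ = solve 4 (λ a b c d → a :+ (b :+ (c :+ d)) := (a :+ c) :+ (b :+ d)) ≈-refl
    regroup₄ : ∀ a b c d → a + (b + (c + d)) ≈ (a + d) + (b + c)
    regroup₄ = solve 4 (λ a b c d → a :+ (b :+ (c :+ d)) := (a :+ d) :+ (b :+ c)) ≈-refl
    cancel : ∀ {s x y} → s ≈ 0# → s ≈ x + y → x ≈ 0# → y ≈ 0#
    cancel {y = y} s≈0 s≈x+y x≈0 = ≈-trans (≈-sym (≈-trans s≈x+y (≈-trans (+-congʳ x≈0) (+-identityˡ y)))) s≈0
    complete₂ : ∀ {x x′ y y′} → a + (b + (c + d)) ≈ x + y → a′ + (b′ + (c′ + d′)) ≈ x′ + y′ →
      (x , x′) ≈ₚ 0ₚ → (x , x′) ≈ₚ 0ₚ × (y , y′) ≈ₚ 0ₚ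
    complete₂ e e′ (x≈0 , x′≈0) = (x≈0 , x′≈0) , cancel h e x≈0 , cancel h′ e′ x′≈0

  P+Q≈0⇒P≈-Q : P +ₚ Q ≈ₚ 0ₚ → P ≈ₚ -ₚ Q
  P+Q≈0⇒P≈-Q (p , q) = +-inverseˡ-unique _ _ p , +-inverseˡ-unique _ _ q

  P+Q≈0⇒Q≈-P : P +ₚ Q ≈ₚ 0ₚ → Q ≈ₚ -ₚ P
  P+Q≈0⇒Q≈-P (p , q) = P+Q≈0⇒P≈-Q (≈-trans (+-comm _ _) p , ≈-trans (+-comm _ _) q)

  -- `U - V` and `U + V` are orthogonal because the norms agree, and parallel because their `∧` is
  -- twice `U ∧ V`; hence one of them is zero.
  unit-parallel : ∥ U ∥² ≈ 1# → ∥ V ∥² ≈ 1# → U ∧ V ≈ 0# → U ≈ₚ V ⊎ U ≈ₚ -ₚ V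
  unit-parallel {u , u′} {v , v′} nU nV U∧V≈0 = Sum.map P-Q≈0⇒P≈Q
    P+Q≈0⇒P≈-Q
    (orthogonal-parallel {u - v , u′ - v′} {u + v , u′ + v′}
      (≈-trans (solve 4 (λ u u′ v v′ → (u :- v) :* (u :+ v) :+ (u′ :- v′) :* (u′ :+ v′)
                  := (u :* u :+ u′ :* u′) :- (v :* v :+ v′ :* v′)) ≈-refl u u′ v v′)
        (x≈y⇒x-y≈0 (≈-trans nU (≈-sym nV))))
      (≈-trans (solve 4 (λ u u′ v v′ → let cross = u :* v′ :- u′ :* v in
                  (u :- v) :* (u′ :+ v′) :- (u′ :- v′) :* (u :+ v) := cross :+ cross) ≈-refl u u′ v v′)
        (≈-trans (+-cong U∧V≈0 U∧V≈0) (+-identityˡ 0#))))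

  OnSegment-sym : ∀ {P Q X} → OnSegment P Q X → OnSegment Q P X
  OnSegment-sym {p , p′} {q , q′} (t , 0≤t , t≤1 , e , f) =
    1# - t , x≤y⇒0≤y-x t≤1 , 0≤y-x⇒x≤y (≤-respʳ-≈ (solve 1 (λ t → t := con (1 , 0) :- (con (1 , 0) :- t))
                    ≈-refl t) 0≤t) ,
    ≈-trans e (reparametrise t p q) , ≈-trans f (reparametrise t p′ q′)
    where
    reparametrise : ∀ t p q → p + t * (q - p) ≈ q + (1# - t) * (p - q)
    reparametrise = solve 3 (λ t p q → p :+ t :* (q :- p) := q :+ (con (1 , 0) :- t) :* (p :- q)) ≈-refl

  UnitVector-flip : ∀ {P Q U} → UnitVector P Q U → UnitVector Q P (-ₚ U)
  UnitVector-flip {U = u , u′} (norm , ray) =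
    ≈-trans (solve 2 (λ u u′ → :- u :* :- u :+ :- u′ :* :- u′ := u :* u :+ u′ :* u′) ≈-refl u u′) norm ,
    ∥⁺-trans (≈ₚ⇒∥⁺ -ₚ-flip) (∥⁺-neg ray)

-- Finite combinatorics: enumerations, pairings of four objects, parity.

enumeration-≤ : ∀ {A : Set} {P : A → Set} {m n} → Enumeration P m → Enumeration P n → m ℕ.≤ n
enumeration-≤ E F = Fin.injective⇒≤ {f = λ i → proj₁ (F.complete (E.sound i))} λ {i} {j} eq →
  E.injective (≡.trans (≡.sym (proj₂ (F.complete (E.sound i))))
    (≡.trans (≡.cong F.elem eq) (proj₂ (F.complete (E.sound j)))))
  where
  module E = Enumeration E
  module F = Enumeration F

enumeration-unique : ∀ {A : Set} {P : A → Set} {m n} → Enumeration P m → Enumeration P n → m ≡ n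
enumeration-unique E F = ℕ.≤-antisym (enumeration-≤ E F) (enumeration-≤ F E)

singleton-unique : ∀ {A : Set} {P : A → Set} {x y} → Enumeration P 1 → P x → P y → x ≡ y
singleton-unique E Px Py with Enumeration.complete E Px | Enumeration.complete E Py
... | zero , ≡.refl | zero , ≡.refl = ≡.refl

opposite₂ : ∀ (a b : Fin 2) → a ≡ b ⊎ opposite a ≡ b
opposite₂ zero       zero       = inj₁ ≡.refl
opposite₂ zero       (suc zero) = inj₂ ≡.refl
opposite₂ (suc zero) zero       = inj₂ ≡.refl
opposite₂ (suc zero) (suc zero) = inj₁ ≡.refl

-- The three perfect matchings of four objects, in the order of the alternatives of `rhombus`: `p`
-- is the matching, `a` one of its two pairs, `s` a member of that pair.
pairing : Fin 3 → Fin 2 → Fin 2 → Fin 4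
pairing p a s = lookup (lookup (lookup table p) a) s
  where
  table : Vec (Vec (Vec (Fin 4) 2) 2) 3
  table = ((i₀ ∷ i₁ ∷ []) ∷ (i₂ ∷ i₃ ∷ []) ∷ [])
        ∷ ((i₀ ∷ i₂ ∷ []) ∷ (i₁ ∷ i₃ ∷ []) ∷ [])
        ∷ ((i₀ ∷ i₃ ∷ []) ∷ (i₁ ∷ i₂ ∷ []) ∷ []) ∷ []
    where
    i₀ i₁ i₂ i₃ : Fin 4
    i₀ = zero
    i₁ = suc zero
    i₂ = suc (suc zero)
    i₃ = suc (suc (suc zero))

pairing-distinct : ∀ p a s t → pairing p a s ≢ pairing p (opposite a) t
pairing-distinct = from-yes (Fin.all? λ p → Fin.all? λ a → Fin.all? λ s → Fin.all? λ t →
  ¬? (pairing p a s Fin.≟ pairing p (opposite a) t))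

pairing-surjective : ∀ p i → ∃[ a ] ∃[ s ] pairing p a s ≡ i
pairing-surjective = from-yes (Fin.all? λ p → Fin.all? λ i → Fin.any? λ a → Fin.any? λ s →
  pairing p a s Fin.≟ i)

-- Exactly one of `i` and `τ i` lies below its image. Summing this over all `i`, and reindexing one
-- of the two resulting sums by `τ`, expresses `n` as twice a sum.
fixpoint-free-involution⇒even : ∀ {n} (τ : Fin n → Fin n) →
  (∀ i → τ (τ i) ≡ i) → (∀ i → τ i ≢ i) → 2 ∣ n
fixpoint-free-involution⇒even {n} τ involutive fixpoint-free = divides (sum below) (begin
  n                                    ≡⟨ sum-ones n ⟨
  sum {n} (λ _ → 1)                    ≡⟨ sum-cong-≗ either ⟩
  sum (λ i → below i ℕ.+ below (τ i))  ≡⟨ ∑-distrib-+ below (below ∘ τ) ⟩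
  sum below ℕ.+ sum (below ∘ τ)
    ≡⟨ ≡.cong (sum below ℕ.+_) (sum-permute below (permutation τ τ involutive involutive)) ⟨
  sum below ℕ.+ sum below              ≡⟨ ≡.cong (sum below ℕ.+_) (ℕ.+-identityʳ (sum below)) ⟨
  2 ℕ.* sum below                      ≡⟨ ℕ.*-comm 2 (sum below) ⟩
  sum below ℕ.* 2                      ∎)
  where
  open ≡.≡-Reasoning
  open CommutativeMonoidSum ℕ.+-0-commutativeMonoid using (sum; sum-permute; ∑-distrib-+; sum-cong-≗)
  sum-ones : ∀ n → sum {n} (λ _ → 1) ≡ n
  sum-ones ℕ.zero    = ≡.refl
  sum-ones (ℕ.suc n) = ≡.cong ℕ.suc (sum-ones n)
  [_<_] : Fin n → Fin n → ℕ
  [ i < j ] = if ⌊ i Fin.<? j ⌋ then 1 else 0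
  below : Fin n → ℕ
  below i = [ i < τ i ]
  exactly-one : ∀ {i j} → j ≢ i → 1 ≡ [ i < j ] ℕ.+ [ j < i ]
  exactly-one {i} {j} j≢i with i Fin.<? j | j Fin.<? i
  ... | yes i<j | yes j<i = contradiction i<j (Fin.<-asym j<i)
  ... | yes _   | no  _   = ≡.refl
  ... | no  _   | yes _   = ≡.refl
  ... | no  i≮j | no  j≮i = contradiction (Fin.≤-antisym (ℕ.≮⇒≥ i≮j) (ℕ.≮⇒≥ j≮i)) j≢i
  either : ∀ i → 1 ≡ below i ℕ.+ below (τ i)
  either i = ≡.trans (exactly-one (fixpoint-free i)) (≡.cong (λ j → below i ℕ.+ [ τ i < j ]) (≡.sym (involutive i)))

-- Upper bound: straight lines through a finite critical graph.

module FiniteCriticalGraph (𝓡 : RealField) (G : Plane.Graph 𝓡)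
  (critical : Plane.Critical 𝓡 G) (regular : Plane.BoundaryRegular 𝓡 G 4)
  (n : ℕ) (boundary : Plane.Graph.HasBoundarySize {𝓡} G n)
  (N : ℕ) (count : Fin N ↔ Plane.Graph.Vertex G) where

  open OrderedField 𝓡
  open Plane 𝓡
  open PlaneVectors 𝓡
  open Graph G
  module ∂ = Enumeration boundary

  private variable
    u v w x y z y′ z′ v′ w′ : Vertex

  infix 5 _⟶_
  _⟶_ : Vertex → Vertex → Point
  v ⟶ w = position w -ₚ position v

  boundary? : ∀ v → Dec (IsBoundary v)
  boundary? v = map′ (λ { (i , ≡.refl) → ∂.sound i }) ∂.complete
    (Fin.any? λ i → Fin.inj⇒≟ (↔⇒↣ (↔-sym count)) (∂.elem i) v)

  adj-≢ : Adj v w → v ≢ w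
  adj-≢ a v≡w = adj-irrefl v≡w a

  ⟶-≉0 : v ≢ w → ¬ (v ⟶ w) ≈ₚ 0ₚ
  ⟶-≉0 v≢w h = v≢w (≡.sym (position-inj (P-Q≈0⇒P≈Q h)))

  OnEdge-≼ : v ⟶ x ≼ v ⟶ y → OnEdge v y (position x)
  OnEdge-≼ (t , 0≤t , t≤1 , h , h′) = t , 0≤t , t≤1 , on h , on h′
    where
    on : ∀ {p q r} → q - p ≈ t * (r - p) → q ≈ p + t * (r - p)
    on {p} {q} h = ≈-trans (solve 2 (λ p q → q := p :+ (q :- p)) ≈-refl p q) (+-congˡ h)

  OnEdge-end : OnEdge v x (position x)
  OnEdge-end = OnEdge-≼ (1# , inj₁ 0<1 , inj₂ ≈-refl , ≈-sym (*-identityˡ _) , ≈-sym (*-identityˡ _))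

  -- Otherwise the nearer neighbour would lie inside the edge to the other.
  same-ray : Adj v w → Adj v w′ → v ⟶ w ∥⁺ v ⟶ w′ → w ≡ w′
  same-ray {v} a a′ h =
    [ nested a a′ , ≡.sym ∘ nested a′ a ]′ (∥⁺⇒≼ h)
    where
    nested : Adj v x → Adj v y → v ⟶ x ≼ v ⟶ y → x ≡ y
    nested {x} {y} a b h with Fin.inj⇒≟ (↔⇒↣ (↔-sym count)) x y
    ... | yes x≡y = x≡y
    ... | no  x≢y with crossing a b [ (λ { (_ , x≡y) → x≢y x≡y }) , (λ { (v≡y , _) → adj-≢ b v≡y }) ]′
                         OnEdge-end (OnEdge-≼ h)
    ...   | z , x≈z , _ , z∈vy with position-inj x≈z
    ...     | ≡.refl = [ (λ x≡v → contradiction (≡.sym x≡v) (adj-≢ a)) , (λ x≡y → x≡y) ]′ z∈vy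

  -- A straight walk is indexed by its first and last directed edges rather than by vertices.
  -- Concatenation then overlaps in a whole edge, which is what guarantees that no bend occurs at
  -- the joint.
  data Straight (v w : Vertex) : Vertex → Vertex → Set where
    stop : Straight v w v w
    go   : Adj v w → Adj w x → w ⟶ x ∥⁺ v ⟶ w → Straight w x y z → Straight v w y z

  infixr 5 _++_
  _++_ : Straight v w x y → Straight x y z u → Straight v w z u
  stop         ++ q = q
  go a b h p ++ q = go a b h (p ++ q)

  reverse : Straight v w y z → Straight z y w v
  reverse stop         = stop
  reverse (go a b h p) = reverse p ++ go (adj-sym b) (adj-sym a) (∥⁺-sym (∥⁺-flip h)) stop

  last-adj : Adj v w → Straight v w y z → Adj y z
  last-adj a stop         = a
  last-adj _ (go _ b _ p) = last-adj b p

  -- All steps are positive multiples of the first, hence so is their sum. This is how a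
  -- combinatorial walk yields a statement about positions.
  direction : Straight v w y z → v ⟶ z ∥⁺ v ⟶ w
  direction stop         = ∥⁺-refl
  direction (go _ _ h p) = ∥⁺-chain (∥⁺-trans (direction p) h) ∥⁺-refl

  -- A boundary vertex could only be left by turning back to `v`, and a nonzero vector does not
  -- point along its own negative.
  boundary-stops : Adj v w → Adj w x → w ⟶ x ∥⁺ v ⟶ w → ¬ IsBoundary w
  boundary-stops a b h w∂ with singleton-unique w∂ (adj-sym a) b
  ... | ≡.refl = ⟶-≉0 (adj-≢ b) (∥⁺-irrefl-neg (∥⁺-trans h (≈ₚ⇒∥⁺ -ₚ-flip)))

  -- At each step `same-ray` leaves one way to go straight on, and by `boundary-stops` neither walk
  -- can pass through the boundary vertex where the other one stops.
  deterministic : IsBoundary z → IsBoundary z′ → Straight v w y z → Straight v w y′ z′ → z ≡ z′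
  deterministic _  _   stop         stop         = ≡.refl
  deterministic z∂ _   stop         (go a b h _) = contradiction z∂ (boundary-stops a b h)
  deterministic _  z′∂ (go a b h _) stop         = contradiction z′∂ (boundary-stops a b h)
  deterministic z∂ z′∂ (go a b h p) (go _ c k q) =
    deterministic z∂ z′∂ p (redirect (same-ray c b (∥⁺-trans k (∥⁺-sym h))) q)
    where
    redirect : x ≡ y → Straight w x u v → Straight w y u v
    redirect ≡.refl r = r

  -- Here `a` selects one of the two lines through `v` and `s` a side of it. Directions in
  -- `independent` point towards `v`, as they do when `v` is viewed from the ends of its lines.
  record Crossing (v : Vertex) : Set where
    field
      arm         : Fin 2 → Fin 2 → Vertex
      adj         : ∀ a s → Adj v (arm a s)
      covers      : Adj v w → ∃[ a ] ∃[ s ] arm a s ≡ w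
      straight    : ∀ a s → v ⟶ arm a (opposite s) ∥⁺ arm a s ⟶ v
      independent : ∀ a s t → ¬ (arm a s ⟶ v) ∧ (arm (opposite a) t ⟶ v) ≈ 0#

    arm-distinct : ∀ a s t → arm a s ≢ arm (opposite a) t
    arm-distinct a s t eq = independent a s t (≈-trans
      (∧-cong (≈-refl , ≈-refl) (≈ₚ-reflexive (≡.cong (_⟶ v) (≡.sym eq)))) (∧-self (arm a s ⟶ v)))

    arm-injective : ∀ {a s b t} → arm a s ≡ arm b t → a ≡ b × s ≡ t
    arm-injective {a} {s} {b} {t} eq with opposite₂ a b | opposite₂ s t
    ... | inj₂ ≡.refl | _           = contradiction eq (arm-distinct a s t)
    ... | inj₁ ≡.refl | inj₁ s≡t    = ≡.refl , s≡t
    ... | inj₁ ≡.refl | inj₂ ≡.refl = contradiction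
      (∥⁺-irrefl-neg (∥⁺-trans (straight a s) (∥⁺-trans (≈ₚ⇒∥⁺ -ₚ-flip)
        (≈ₚ⇒∥⁺ (≈ₚ-reflexive (≡.cong (λ w → -ₚ (v ⟶ w)) eq))))))
      (⟶-≉0 (adj-≢ (adj a (opposite s))))

  crossingAt : ∀ v → ¬ IsBoundary v → Crossing v
  crossingAt v v° with critical v v°
  -- `Balanced` carries its own enumeration of the neighbours; comparison with regularity forces its
  -- length to be 4.
  ... | d , nbr , U , unit , ΣU≈0 with enumeration-unique nbr (regular v v°)
  ...   | ≡.refl = paired (rhombus
                    (norm zero) (norm (suc zero)) (norm (suc (suc zero))) (norm (suc (suc (suc zero))))
                    (drop0 (proj₁ ΣU≈0) , drop0 (proj₂ ΣU≈0)))
    where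
    module nbr = Enumeration nbr
    norm : ∀ i → ∥ U i ∥² ≈ 1#
    norm i = proj₁ (unit i)
    ray : ∀ i → v ⟶ nbr.elem i ∥⁺ U i
    ray i = proj₂ (unit i)
    drop0 : ∀ {a b c d} → a + (b + (c + (d + 0#))) ≈ 0# → a + (b + (c + d)) ≈ 0#
    drop0 = ≈-trans (+-congˡ (+-congˡ (+-congˡ (≈-sym (+-identityʳ _)))))
    U-injective : ∀ {i j} → U i ≈ₚ U j → i ≡ j
    U-injective {i} {j} Ui≈Uj = nbr.injective (same-ray (nbr.sound i) (nbr.sound j)
      (∥⁺-trans (ray i) (∥⁺-trans (≈ₚ⇒∥⁺ Ui≈Uj) (∥⁺-sym (ray j)))))
    fromPairing : ∀ p → (∀ a → U (pairing p a zero) +ₚ U (pairing p a (suc zero)) ≈ₚ 0ₚ) → Crossing v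
    fromPairing p sums = record
      { arm         = λ a s → nbr.elem (σ a s)
      ; adj         = λ a s → nbr.sound (σ a s)
      ; covers      = covers′
      ; straight    = back
      -- Parallel unit vectors are equal or opposite, and the opposite of a vector belongs to its
      -- partner in the pairing. Either way one neighbour would lie in both pairs.
      ; independent = λ a s t → ∧-∥⁺-≉0 (ray′ a s) (ray′ (opposite a) t)
          ([ pairing-distinct p a (opposite s) (opposite t) ∘ U-injective
           , (λ Us≈-Ut → pairing-distinct p a (opposite s) (opposite (opposite t))
               (U-injective (≈ₚ-trans Us≈-Ut (≈ₚ-sym (opp (opposite a) (opposite t))))))
           ]′ ∘ unit-parallel (norm (σ a (opposite s))) (norm (σ (opposite a) (opposite t))))
      }
      where
      σ : Fin 2 → Fin 2 → Fin 4
      σ = pairing p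
      opp : ∀ a s → U (σ a (opposite s)) ≈ₚ -ₚ U (σ a s)
      opp a zero       = P+Q≈0⇒Q≈-P (sums a)
      opp a (suc zero) = P+Q≈0⇒P≈-Q (sums a)
      back : ∀ a s → v ⟶ nbr.elem (σ a (opposite s)) ∥⁺ nbr.elem (σ a s) ⟶ v
      back a s = ∥⁺-trans (ray (σ a (opposite s))) (∥⁺-trans (≈ₚ⇒∥⁺ (opp a s))
        (∥⁺-sym (∥⁺-trans (≈ₚ⇒∥⁺ -ₚ-flip) (∥⁺-neg (ray (σ a s))))))
      ray′ : ∀ a s → nbr.elem (σ a s) ⟶ v ∥⁺ U (σ a (opposite s))
      ray′ a s = ∥⁺-trans (∥⁺-sym (back a s)) (ray (σ a (opposite s)))
      covers′ : Adj v w → ∃[ a ] ∃[ s ] nbr.elem (σ a s) ≡ w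
      covers′ vw with nbr.complete vw
      ... | i , ≡.refl with pairing-surjective p i
      ...   | a , s , σ≡i = a , s , ≡.cong nbr.elem σ≡i
    paired : _ → Crossing v
    paired (inj₁ (e , f))        = fromPairing zero λ { zero → e ; (suc zero) → f }
    paired (inj₂ (inj₁ (e , f))) = fromPairing (suc zero) λ { zero → e ; (suc zero) → f }
    paired (inj₂ (inj₂ (e , f))) = fromPairing (suc (suc zero)) λ { zero → e ; (suc zero) → f }

  -- Walking straight on increases the height, so in a finite graph the walk
  -- ends, and it can only end at the boundary.
  extend : Adj v w → ∃[ y ] ∃[ z ] IsBoundary z × Straight v w y z
  extend {v₀} {w₀} v₀w₀ = walk v₀w₀ ∥⁺-refl (noetherian (from w₀))
    where
    open Inverse count using (to; from; strictlyInverseˡ)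
    δ : Point
    δ = v₀ ⟶ w₀
    height : Fin N → Carrier
    height i = δ ∙ position (to i)
    noetherian : ∀ i → Acc (λ i j → height j < height i) i
    noetherian = spo-noetherian (On.isStrictPartialOrder height isStrictPartialOrder)
    higher : w ⟶ x ∥⁺ δ → height (from w) < height (from x)
    higher {w} {x} h = ≡.subst₂ (λ w x → δ ∙ position w < δ ∙ position x)
      (≡.sym (strictlyInverseˡ w)) (≡.sym (strictlyInverseˡ x))
      (0<y-x⇒x<y (<-respʳ-≈ (∙-distribˡ-- δ (position x) (position w)) (∙-∥⁺-pos (⟶-≉0 (adj-≢ v₀w₀)) h)))
    walk : Adj v w → v ⟶ w ∥⁺ δ → Acc (λ i j → height j < height i) (from w) →
      ∃[ y ] ∃[ z ] IsBoundary z × Straight v w y z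
    walk {v} {w} vw h (acc rec) with boundary? w
    ... | yes w∂ = v , w , w∂ , stop
    ... | no  w° = continue (covers (adj-sym vw))
      where
      open Crossing (crossingAt w w°)
      continue : (∃[ a ] ∃[ s ] arm a s ≡ v) → _
      continue (a , s , ≡.refl) =
        let k = straight a s
            y , z , z∂ , p = walk (adj a (opposite s)) (∥⁺-trans k h) (rec (higher (∥⁺-trans k h)))
        in y , z , z∂ , go vw (adj a (opposite s)) k p

  end : Adj v w → Fin n
  end vw = proj₁ (∂.complete (proj₁ (proj₂ (proj₂ (extend vw)))))

  straight-to-end : (vw : Adj v w) → ∃[ y ] Straight v w y (∂.elem (end vw))
  straight-to-end vw with extend vw
  ... | y , z , z∂ , p with ∂.complete z∂
  ...   | i , ≡.refl = y , p

  end-unique : ∀ {i} (vw : Adj v w) → Straight v w y (∂.elem i) → end vw ≡ i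
  end-unique vw p = ∂.injective
    (deterministic (∂.sound _) (∂.sound _) (proj₂ (straight-to-end vw)) p)

  -- By `direction` the common end is seen from `v` along both edges, so the edges leave `v` on the
  -- same ray.
  end-injective : (vw : Adj v w) (vw′ : Adj v w′) → end vw ≡ end vw′ → w ≡ w′
  end-injective {v} vw vw′ eq = same-ray vw vw′ (∥⁺-trans
    (∥⁺-sym (direction (proj₂ (straight-to-end vw))))
    (∥⁺-trans (≈ₚ⇒∥⁺ (≈ₚ-reflexive (≡.cong (λ i → v ⟶ ∂.elem i) eq))) (direction (proj₂ (straight-to-end vw′)))))

  inward : Fin n → Vertex
  inward i = Enumeration.elem (∂.sound i) zero

  inward-adj : ∀ i → Adj (∂.elem i) (inward i)
  inward-adj i = Enumeration.sound (∂.sound i) zero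

  τ : Fin n → Fin n
  τ i = end (inward-adj i)

  -- The walk from `v` to its end, reversed: a boundary point has one edge, so the reversed walk has
  -- to start with the inward one.
  inward-walk : (vw : Adj v w) → Straight (∂.elem (end vw)) (inward (end vw)) w v
  inward-walk {v} {w} vw with straight-to-end vw
  ... | y , p with singleton-unique (∂.sound (end vw)) (inward-adj (end vw)) (adj-sym (last-adj vw p))
  ...   | inward≡y = ≡.subst (λ y → Straight (∂.elem (end vw)) y w v) (≡.sym inward≡y) (reverse p)

  τ-involutive : ∀ i → τ (τ i) ≡ i
  τ-involutive i = end-unique (inward-adj (τ i)) (inward-walk (inward-adj i))

  -- The displacement from `i` to `τ i` is a positive multiple of a nonzero first step.
  τ-fixpoint-free : ∀ i → τ i ≢ i
  τ-fixpoint-free i τi≡i with straight-to-end (inward-adj i)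
  ... | y , p = ∥⁺-≉0 (direction p) (⟶-≉0 (adj-≢ (inward-adj i)))
    (x≈y⇒x-y≈0 (proj₁ at-i) , x≈y⇒x-y≈0 (proj₂ at-i))
    where
    at-i : position (∂.elem (τ i)) ≈ₚ position (∂.elem i)
    at-i = ≈ₚ-reflexive (≡.cong (position ∘ ∂.elem) τi≡i)

  -- The walk from one end back to `v` joins the walk from `v` onwards, so the two ends of a line
  -- through `v` are exchanged by `τ`.
  τ-end : (vw : Adj v w) (vx : Adj v x) → v ⟶ x ∥⁺ w ⟶ v → τ (end vw) ≡ end vx
  τ-end vw vx h = end-unique (inward-adj (end vw))
    (inward-walk vw ++ go (adj-sym vw) vx h (proj₂ (straight-to-end vx)))

  -- Both vertices lie on the ray along which the shared end sends its only edge.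
  seen-from-end : (vw : Adj v w) (v′w′ : Adj v′ w′) → end vw ≡ end v′w′ →
    ∂.elem (end vw) ⟶ v ∥⁺ ∂.elem (end vw) ⟶ v′
  seen-from-end {v′ = v′} vw v′w′ eq = ∥⁺-trans (direction (inward-walk vw))
    (≡.subst (λ i → ∂.elem i ⟶ inward i ∥⁺ ∂.elem i ⟶ v′) (≡.sym eq) (∥⁺-sym (direction (inward-walk v′w′))))

  -- Upper bound: injecting eight slots per vertex.

  corner : Fin 8 ↔ (Fin 2 × (Fin 2 × Fin 2))
  corner = (↔-refl ×-↔ Fin.*↔× {2} {2}) ↔-∘ Fin.*↔× {2} {4}

  Slot : Set
  Slot = (Fin n × Fin n) ⊎ (Fin n × Fin 6)

  boundarySlot : Fin n → Fin 8 → Slot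
  boundarySlot i zero          = inj₁ (i , i)
  boundarySlot i (suc zero)    = inj₁ (i , τ i)
  boundarySlot i (suc (suc k)) = inj₂ (i , k)

  armSlot : Crossing v → Fin 2 × (Fin 2 × Fin 2) → Slot
  armSlot c (a , s , t) = inj₁ (end (adj a s) , end (adj (opposite a) t))
    where open Crossing c

  -- An interior vertex occupies the eight pairs of ends of its two lines, a
  -- boundary point i the pairs (i , i) and (i , τ i) and six spare slots.
  slot : ∀ v → Dec (IsBoundary v) → Fin 8 → Slot
  slot v (yes v∂) k = boundarySlot (proj₁ (∂.complete v∂)) k
  slot v (no v°)  k = armSlot (crossingAt v v°) (Inverse.to corner k)

  boundarySlot-injective : ∀ {i j} k l → boundarySlot i k ≡ boundarySlot j l → i ≡ j × k ≡ l
  boundarySlot-injective zero          zero          ≡.refl = ≡.refl , ≡.refl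
  boundarySlot-injective zero          (suc zero)    eq     = contradiction
    (≡.trans (≡.sym (proj₂ ij)) (proj₁ ij)) (τ-fixpoint-free _)
    where ij = ,-injective (inj₁-injective eq)
  boundarySlot-injective (suc zero)    zero          eq     = contradiction
    (≡.trans (proj₂ ij) (≡.sym (proj₁ ij))) (τ-fixpoint-free _)
    where ij = ,-injective (inj₁-injective eq)
  boundarySlot-injective (suc zero)    (suc zero)    eq     = proj₁ (,-injective (inj₁-injective eq)) , ≡.refl
  boundarySlot-injective (suc (suc k)) (suc (suc l)) ≡.refl = ≡.refl , ≡.refl

  -- The pair (i , i) would give two different arms the same end. The pair (i , τ i) reduces to this
  -- case: by `τ-end`, `τ i` is the end of the opposite arm of the first line.
  boundarySlot≢armSlot : ∀ {i} (c : Crossing v) k q → boundarySlot i k ≢ armSlot c q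
  boundarySlot≢armSlot {i = i} c zero (a , s , t) eq =
    arm-distinct a s t (end-injective (adj a s) (adj (opposite a) t)
      (≡.trans (≡.sym (proj₁ ij)) (proj₂ ij)))
    where
    open Crossing c
    ij : i ≡ end (adj a s) × i ≡ end (adj (opposite a) t)
    ij = ,-injective (inj₁-injective eq)
  boundarySlot≢armSlot {i = i} c (suc zero) (a , s , t) eq =
    arm-distinct a (opposite s) t (end-injective (adj a (opposite s)) (adj (opposite a) t)
      (≡.trans (≡.sym (τ-end (adj a s) (adj a (opposite s)) (straight a s)))
        (≡.trans (≡.cong τ (≡.sym (proj₁ ij))) (proj₂ ij))))
    where
    open Crossing c
    ij : i ≡ end (adj a s) × τ i ≡ end (adj (opposite a) t)
    ij = ,-injective (inj₁-injective eq)

  armSlot-injective : ∀ (c : Crossing v) {q r} → armSlot c q ≡ armSlot c r → q ≡ r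
  armSlot-injective c {a , s , t} {a′ , s′ , t′} eq =
    ≡.cong₂ _,_ (proj₁ as) (≡.cong₂ _,_ (proj₂ as) (proj₂ bt))
    where
    open Crossing c
    ij : end (adj a s) ≡ end (adj a′ s′) × end (adj (opposite a) t) ≡ end (adj (opposite a′) t′)
    ij = ,-injective (inj₁-injective eq)
    as : a ≡ a′ × s ≡ s′
    as = arm-injective (end-injective (adj a s) (adj a′ s′) (proj₁ ij))
    bt : opposite a ≡ opposite a′ × t ≡ t′
    bt = arm-injective (end-injective (adj (opposite a) t) (adj (opposite a′) t′) (proj₂ ij))

  -- Two boundary points serve as stations for `triangulate`: both see `v` and `v′` in the same
  -- direction, and the lines of sight are not parallel because the two lines through `v` are
  -- transversal.
  armSlot-vertex : ∀ (c : Crossing v) (c′ : Crossing v′) q q′ → armSlot c q ≡ armSlot c′ q′ → v′ ≡ v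
  armSlot-vertex {v} {v′} c c′ (a , s , t) (a′ , s′ , t′) eq = position-inj (triangulate
    (∥⁺-sym (seen-from-end (c.adj a s) (c′.adj a′ s′) (proj₁ ij)))
    (∥⁺-sym (seen-from-end (c.adj (opposite a) t) (c′.adj (opposite a′) t′) (proj₂ ij)))
    (∧-∥⁺-≉0 (towards (c.adj a s)) (towards (c.adj (opposite a) t)) (c.independent a s t)))
    where
    module c = Crossing c
    module c′ = Crossing c′
    ij : end (c.adj a s) ≡ end (c′.adj a′ s′) × end (c.adj (opposite a) t) ≡ end (c′.adj (opposite a′) t′)
    ij = ,-injective (inj₁-injective eq)
    towards : (vw : Adj v w) → ∂.elem (end vw) ⟶ v ∥⁺ w ⟶ v
    towards vw = ∥⁺-flip (direction (proj₂ (straight-to-end vw)))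

  slot-vertex : ∀ {v v′} d d′ {k k′} → slot v d k ≡ slot v′ d′ k′ → v ≡ v′
  slot-vertex (yes v∂) (yes v′∂) {k} {k′} eq = ≡.trans (≡.sym (proj₂ (∂.complete v∂)))
    (≡.trans (≡.cong ∂.elem (proj₁ (boundarySlot-injective k k′ eq))) (proj₂ (∂.complete v′∂)))
  slot-vertex (yes _)  (no v′°) {k} {k′} eq = contradiction eq (boundarySlot≢armSlot (crossingAt _ v′°) k _)
  slot-vertex (no v°)  (yes _)  {k} {k′} eq = contradiction (≡.sym eq) (boundarySlot≢armSlot (crossingAt _ v°) k′ _)
  slot-vertex (no v°)  (no v′°) eq = ≡.sym (armSlot-vertex (crossingAt _ v°) (crossingAt _ v′°) _ _ eq)

  slot-injective : ∀ {v} d {k k′} → slot v d k ≡ slot v d k′ → k ≡ k′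
  slot-injective (yes _) {k} {k′} eq = proj₂ (boundarySlot-injective k k′ eq)
  slot-injective (no v°) eq = Injection.injective (↔⇒↣ corner) (armSlot-injective (crossingAt _ v°) eq)

  slots : (Vertex × Fin 8) ↣ Slot
  slots = mk↣ {to = λ { (v , k) → slot v (boundary? v) k }} λ {vk vk′} → injective vk vk′
    where
    injective : ∀ vk vk′ → slot (proj₁ vk) (boundary? (proj₁ vk)) (proj₂ vk)
      ≡ slot (proj₁ vk′) (boundary? (proj₁ vk′)) (proj₂ vk′) → vk ≡ vk′
    injective (v , k) (v′ , k′) eq with slot-vertex (boundary? v) (boundary? v′) {k} {k′} eq
    ... | ≡.refl = ≡.cong (v ,_) (slot-injective (boundary? v) eq)

  8N≤n²+6n : N ℕ.* 8 ℕ.≤ n ℕ.* n ℕ.+ n ℕ.* 6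
  8N≤n²+6n = Fin.injective⇒≤ (Injection.injective
    (↔⇒↣ (↔-sym Fin.+↔⊎ ↔-∘ (↔-sym Fin.*↔× ⊎-↔ ↔-sym Fin.*↔×))
      ↣-∘ (slots ↣-∘ ↔⇒↣ ((count ×-↔ ↔-refl) ↔-∘ Fin.*↔×))))

  n-even : 2 ∣ n
  n-even = fixpoint-free-involution⇒even τ τ-involutive τ-fixpoint-free

-- Lower bound: combinatorics of m pairwise crossing lines.

[1+m]C2≡mC2+m : ∀ m → ℕ.suc m C 2 ≡ m C 2 ℕ.+ m
[1+m]C2≡mC2+m m = ≡.trans (≡.sym (nCk+nC[k+1]≡[n+1]C[k+1] m 1))
  (≡.trans (≡.cong (ℕ._+ m C 2) (nC1≡n m)) (ℕ.+-comm m (m C 2)))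

enumerate : ∀ {A : Set} {P : A → Set} {n} (xs : Vec A n) → Unique xs → All P xs →
  (∀ {x} → P x → Any (_≡ x) xs) → Enumeration P n
enumerate xs unique all covers = record
  { elem      = lookup xs
  ; injective = lookup-injective unique _ _
  ; sound     = All.lookup⁺ all
  ; complete  = λ Px → index (covers Px) , lookup-index (covers Px)
  }

-- Pairs lo < hi of numbers below k.
Pair : ℕ → Set
Pair ℕ.zero    = ⊥
Pair (ℕ.suc k) = Pair k ⊎ Fin k

Pair↔Fin : ∀ k → Pair k ↔ Fin (k C 2)
Pair↔Fin ℕ.zero    = mk↔ₛ′ ⊥-elim (λ ()) (λ ()) (λ ())
Pair↔Fin (ℕ.suc k) = ≡.subst (λ c → Pair (ℕ.suc k) ↔ Fin c) (≡.sym ([1+m]C2≡mC2+m k))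
  (↔-sym Fin.+↔⊎ ↔-∘ (Pair↔Fin k ⊎-↔ ↔-refl))

pairLo pairHi : ∀ {k} → Pair k → ℕ
pairLo {ℕ.suc k} (inj₁ p) = pairLo p
pairLo {ℕ.suc k} (inj₂ i) = Fin.toℕ i
pairHi {ℕ.suc k} (inj₁ p) = pairHi p
pairHi {ℕ.suc k} (inj₂ i) = k

pairHi<k : ∀ {k} (p : Pair k) → pairHi p ℕ.< k
pairHi<k {ℕ.suc k} (inj₁ p) = ℕ.m<n⇒m<1+n (pairHi<k p)
pairHi<k {ℕ.suc k} (inj₂ i) = ℕ.n<1+n k

pairLo<pairHi : ∀ {k} (p : Pair k) → pairLo p ℕ.< pairHi p
pairLo<pairHi {ℕ.suc k} (inj₁ p) = pairLo<pairHi p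
pairLo<pairHi {ℕ.suc k} (inj₂ i) = Fin.toℕ<n i

pair-ext : ∀ {k} (p p′ : Pair k) → pairLo p ≡ pairLo p′ → pairHi p ≡ pairHi p′ → p ≡ p′
pair-ext {ℕ.suc k} (inj₁ p) (inj₁ p′) e f = ≡.cong inj₁ (pair-ext p p′ e f)
pair-ext {ℕ.suc k} (inj₁ p) (inj₂ i)  e f = contradiction f (ℕ.<⇒≢ (pairHi<k p))
pair-ext {ℕ.suc k} (inj₂ i) (inj₁ p)  e f = contradiction (≡.sym f) (ℕ.<⇒≢ (pairHi<k p))
pair-ext {ℕ.suc k} (inj₂ i) (inj₂ j)  e f = ≡.cong inj₂ (Fin.toℕ-injective e)

pair : ∀ {k a b} → a ℕ.< b → b ℕ.< k → ∃[ p ] pairLo {k} p ≡ a × pairHi p ≡ b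
pair {ℕ.suc k} a<b b<1+k with ℕ.m<1+n⇒m<n∨m≡n b<1+k
... | inj₂ ≡.refl = inj₂ (Fin.fromℕ< a<b) , Fin.toℕ-fromℕ< a<b , ≡.refl
... | inj₁ b<k with pair a<b b<k
...   | p , e , f = inj₁ p , e , f

-- Lines 1, …, m, crossing at the pairs of lines; the points {c , 0} and
-- {c , m + 1} are the ends of line c.
module LineArrangement (m : ℕ) where

  -- All pairs from 0, ..., m + 1 except {0 , m + 1}. The labels 0 and m + 1 stand for two auxiliary
  -- lines that only cut off the ends of the others, so their own intersection is left out.
  Vertex : Set
  Vertex = Pair (ℕ.suc m) ⊎ Fin m

  private variable
    a b c d j k l c′ j′ k′ : ℕ
    u v w : Vertex

  Line : ℕ → Set
  Line c = 1 ℕ.≤ c × c ℕ.≤ m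

  lo hi : Vertex → ℕ
  lo (inj₁ p) = pairLo p
  lo (inj₂ i) = ℕ.suc (Fin.toℕ i)
  hi (inj₁ p) = pairHi p
  hi (inj₂ i) = ℕ.suc m

  lo<hi : ∀ v → lo v ℕ.< hi v
  lo<hi (inj₁ p) = pairLo<pairHi p
  lo<hi (inj₂ i) = ℕ.s<s (Fin.toℕ<n i)

  hi≤1+m : ∀ v → hi v ℕ.≤ ℕ.suc m
  hi≤1+m (inj₁ p) = ℕ.<⇒≤ (pairHi<k p)
  hi≤1+m (inj₂ i) = ℕ.≤-refl

  ext : ∀ u v → lo u ≡ lo v → hi u ≡ hi v → u ≡ v
  ext (inj₁ p) (inj₁ p′) e f = ≡.cong inj₁ (pair-ext p p′ e f)
  ext (inj₁ p) (inj₂ i)  e f = contradiction f (ℕ.<⇒≢ (pairHi<k p))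
  ext (inj₂ i) (inj₁ p)  e f = contradiction (≡.sym f) (ℕ.<⇒≢ (pairHi<k p))
  ext (inj₂ i) (inj₂ j)  e f = ≡.cong inj₂ (Fin.toℕ-injective (ℕ.suc-injective e))

  infix 4 _∈[_,_]
  -- The vertex as an unordered pair, so that either label can play the line and the other the place
  -- on it.
  data _∈[_,_] (v : Vertex) (c j : ℕ) : Set where
    low  : lo v ≡ c → hi v ≡ j → v ∈[ c , j ]
    high : lo v ≡ j → hi v ≡ c → v ∈[ c , j ]

  ∈-swap : v ∈[ c , j ] → v ∈[ j , c ]
  ∈-swap (low e f)  = high e f
  ∈-swap (high e f) = low e f

  ∈-unique : v ∈[ c , j ] → w ∈[ c , j ] → v ≡ w
  ∈-unique (low e f)  (low g h)  = ext _ _ (≡.trans e (≡.sym g)) (≡.trans f (≡.sym h))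
  ∈-unique (high e f) (high g h) = ext _ _ (≡.trans e (≡.sym g)) (≡.trans f (≡.sym h))
  ∈-unique {v} {w = w} (low ≡.refl ≡.refl) (high g h) =
    contradiction (≡.subst₂ ℕ._<_ g h (lo<hi w)) (ℕ.<-asym (lo<hi v))
  ∈-unique {v} {w = w} (high ≡.refl ≡.refl) (low g h) =
    contradiction (≡.subst₂ ℕ._<_ g h (lo<hi w)) (ℕ.<-asym (lo<hi v))

  ∈-determines : v ∈[ c , j ] → v ∈[ d , k ] → (c ≡ d × j ≡ k) ⊎ (c ≡ k × j ≡ d)
  ∈-determines (low ≡.refl ≡.refl)  (low e f)  = inj₁ (e , f)
  ∈-determines (low ≡.refl ≡.refl)  (high e f) = inj₂ (e , f)
  ∈-determines (high ≡.refl ≡.refl) (low e f)  = inj₂ (f , e)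
  ∈-determines (high ≡.refl ≡.refl) (high e f) = inj₁ (f , e)

  ∈-≢ : v ∈[ c , j ] → c ≢ j
  ∈-≢ {v} (low ≡.refl ≡.refl)  = ℕ.<⇒≢ (lo<hi v)
  ∈-≢ {v} (high ≡.refl ≡.refl) = ℕ.<⇒≢ (lo<hi v) ∘ ≡.sym

  ∈-same-line : v ∈[ c , j ] → v ∈[ c , k ] → j ≡ k
  ∈-same-line p q with ∈-determines p q
  ... | inj₁ (_ , j≡k)       = j≡k
  ... | inj₂ (≡.refl , j≡c) = j≡c

  ∈-bound : v ∈[ c , j ] → j ℕ.≤ ℕ.suc m
  ∈-bound {v} (low _ ≡.refl)  = hi≤1+m v
  ∈-bound {v} (high ≡.refl _) = ℕ.<⇒≤ (ℕ.<-≤-trans (lo<hi v) (hi≤1+m v))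

  point : Line c → c ≢ j → j ℕ.≤ ℕ.suc m → ∃[ v ] v ∈[ c , j ]
  point {c} {j} (1≤c , c≤m) c≢j j≤1+m with ℕ.<-cmp c j
  ... | tri≈ _ c≡j _ = contradiction c≡j c≢j
  ... | tri> _ _ j<c with pair j<c (ℕ.s≤s c≤m)
  ...   | p , e , f = inj₁ p , high e f
  point {c} {j} (1≤c , c≤m) c≢j j≤1+m | tri< c<j _ _ with ℕ.m≤n⇒m<n∨m≡n j≤1+m
  ... | inj₁ j<1+m with pair c<j j<1+m
  ...   | p , e , f = inj₁ p , low e f
  point {ℕ.suc c} (_ , c<m) _ _ | tri< _ _ _ | inj₂ ≡.refl =
    inj₂ (Fin.fromℕ< c<m) , low (≡.cong ℕ.suc (Fin.toℕ-fromℕ< c<m)) ≡.refl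

  -- On line c the points {c , j} and {c , k} are consecutive; {c , c} would be
  -- the point of tangency, which is not a vertex.
  record Next (c j k : ℕ) : Set where
    field
      j<k     : j ℕ.< k
      j≢c     : j ≢ c
      k≢c     : k ≢ c
      between : ∀ {l} → j ℕ.< l → l ℕ.< k → l ≡ c

    splits : ∀ {l} → l ≢ c → l ℕ.≤ j ⊎ k ℕ.≤ l
    splits {l} l≢c with ℕ.<-≤-connex j l | ℕ.<-≤-connex l k
    ... | inj₂ l≤j | _        = inj₁ l≤j
    ... | inj₁ _   | inj₂ k≤l = inj₂ k≤l
    ... | inj₁ j<l | inj₁ l<k = contradiction (between j<l l<k) l≢c

  open Next

  -- The successor is `j + 1`, or `c + 1` if that step would hit `c`. The bound keeps it at most
  -- `m + 1` as soon as `j` and `c` are at most `m`.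
  next-up : j ≢ c → ∃[ k ] Next c j k × k ℕ.≤ ℕ.suc j ℕ.⊔ ℕ.suc c
  next-up {j} {c} j≢c with ℕ.suc j ℕ.≟ c
  ... | no 1+j≢c = ℕ.suc j , record
    { j<k = ℕ.n<1+n j ; j≢c = j≢c ; k≢c = 1+j≢c
    ; between = λ j<l l<1+j → contradiction l<1+j (ℕ.≤⇒≯ j<l)
    } , ℕ.m≤m⊔n (ℕ.suc j) (ℕ.suc c)
  ... | yes ≡.refl = ℕ.suc (ℕ.suc j) , record
    { j<k = ℕ.m<n⇒m<1+n (ℕ.n<1+n j) ; j≢c = j≢c ; k≢c = ℕ.1+n≢n
    ; between = λ j<l l<2+j → ℕ.≤-antisym (ℕ.s≤s⁻¹ l<2+j) j<l
    } , ℕ.m≤n⊔m (ℕ.suc j) (ℕ.suc c)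

  -- The predecessor is `k - 1`, or `c - 1` if `k - 1` is `c`; `1 ≤ c` leaves room for the second
  -- case.
  next-down : 1 ℕ.≤ c → 1 ℕ.≤ k → k ≢ c → ∃[ j ] Next c j k
  next-down {c} {ℕ.suc k} 1≤c 1≤k k≢c with k ℕ.≟ c
  ... | no k-1≢c = k , record
    { j<k = ℕ.n<1+n k ; j≢c = k-1≢c ; k≢c = k≢c
    ; between = λ j<l l<1+j → contradiction l<1+j (ℕ.≤⇒≯ j<l)
    }
  next-down {ℕ.suc c} {ℕ.suc _} _ _ k≢c | yes ≡.refl = c , record
    { j<k = ℕ.m<n⇒m<1+n (ℕ.n<1+n c) ; j≢c = ℕ.1+n≢n ∘ ≡.sym ; k≢c = k≢c
    ; between = λ j<l l<2+j → ℕ.≤-antisym (ℕ.s≤s⁻¹ l<2+j) j<l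
    }

  next-functional : Next c j k → Next c j k′ → k ≡ k′
  next-functional p q = ℕ.≤-antisym
    ([ (λ k′≤j → contradiction (j<k q) (ℕ.≤⇒≯ k′≤j)) , (λ k≤k′ → k≤k′) ]′ (splits p (k≢c q)))
    ([ (λ k≤j → contradiction (j<k p) (ℕ.≤⇒≯ k≤j)) , (λ k′≤k → k′≤k) ]′ (splits q (k≢c p)))

  next-injective : Next c j k → Next c j′ k → j ≡ j′
  next-injective p q = ℕ.≤-antisym
    ([ (λ j≤j′ → j≤j′) , (λ k≤j → contradiction (j<k p) (ℕ.≤⇒≯ k≤j)) ]′ (splits q (j≢c p)))
    ([ (λ j′≤j → j′≤j) , (λ k≤j′ → contradiction (j<k q) (ℕ.≤⇒≯ k≤j′)) ]′ (splits p (j≢c q)))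

  record Edge (u v : Vertex) : Set where
    constructor edge
    field
      {line from to} : ℕ
      isLine : Line line
      next   : Next line from to
      from∈  : u ∈[ line , from ]
      to∈    : v ∈[ line , to ]

  Adj : Vertex → Vertex → Set
  Adj u v = Edge u v ⊎ Edge v u

  edge-≢ : Edge u v → u ≢ v
  edge-≢ (edge _ n p q) ≡.refl = ℕ.<⇒≢ (j<k n) (∈-same-line p q)

  up : Line c → v ∈[ c , j ] → j ℕ.≤ m → ∃[ k ] ∃[ w ] Next c j k × w ∈[ c , k ]
  up {c} {j = j} L p j≤m with next-up (∈-≢ p ∘ ≡.sym)
  ... | k , n , k≤ with point L (k≢c n ∘ ≡.sym) (ℕ.≤-trans k≤ (ℕ.⊔-lub (ℕ.s≤s j≤m) (ℕ.s≤s (proj₂ L))))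
  ...   | w , q = k , w , n , q

  down : Line c → v ∈[ c , k ] → 1 ℕ.≤ k → ∃[ j ] ∃[ w ] Next c j k × w ∈[ c , j ]
  down L p 1≤k with next-down (proj₁ L) 1≤k (∈-≢ p ∘ ≡.sym)
  ... | j , n with point L (j≢c n ∘ ≡.sym) (ℕ.<⇒≤ (ℕ.<-≤-trans (j<k n) (∈-bound p)))
  ...   | w , q = j , w , n , q

  data Kind (v : Vertex) : Set where
    interior : ∀ a b → Line a → Line b → v ∈[ a , b ] → Kind v
    end      : ∀ c j → Line c → j ≡ 0 ⊎ j ≡ ℕ.suc m → v ∈[ c , j ] → Kind v

  kind : ∀ v → Kind v
  kind v@(inj₂ i) = end (lo v) (hi v) (ℕ.s≤s ℕ.z≤n , Fin.toℕ<n i) (inj₂ ≡.refl) (low ≡.refl ≡.refl)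
  kind v@(inj₁ p) with lo v in eq
  ... | ℕ.zero  = end (hi v) 0 (ℕ.≤-<-trans ℕ.z≤n (lo<hi v) , ℕ.s≤s⁻¹ (pairHi<k p)) (inj₁ ≡.refl) (high eq ≡.refl)
  ... | ℕ.suc a = interior (ℕ.suc a) (hi v)
    (ℕ.s≤s ℕ.z≤n , ℕ.≤-trans (≡.subst (ℕ._≤ hi v) eq (ℕ.<⇒≤ (lo<hi v))) (ℕ.s≤s⁻¹ (pairHi<k p)))
    (ℕ.≤-<-trans ℕ.z≤n (lo<hi v) , ℕ.s≤s⁻¹ (pairHi<k p)) (low eq ≡.refl)

  -- The extreme labels are not lines, so only `c` can be the line through this vertex.
  line-of-end : Line c → j ≡ 0 ⊎ j ≡ ℕ.suc m → v ∈[ c , j ] → Line d → v ∈[ d , k ] → d ≡ c × k ≡ j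
  line-of-end L e p M q with ∈-determines p q
  ... | inj₁ (≡.refl , ≡.refl) = ≡.refl , ≡.refl
  line-of-end L (inj₁ ≡.refl) p (() , _) q | inj₂ (_ , ≡.refl)
  line-of-end L (inj₂ ≡.refl) p (_ , 1+m≤m) q | inj₂ (_ , ≡.refl) = contradiction 1+m≤m ℕ.1+n≰n

  degree-end : Line c → j ≡ 0 ⊎ j ≡ ℕ.suc m → v ∈[ c , j ] → Enumeration (Adj v) 1
  degree-end {v = v} L (inj₁ ≡.refl) p with up L p ℕ.z≤n
  ... | k , w , n , q = enumerate (w ∷ []) ([] ∷ []) (inj₁ (edge L n p q) ∷ []) (here ∘ covers)
    where
    covers : Adj v u → w ≡ u
    covers (inj₁ (edge L′ n′ p′ q′)) with line-of-end L (inj₁ ≡.refl) p L′ p′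
    ... | ≡.refl , ≡.refl with next-functional n n′
    ...   | ≡.refl = ∈-unique q q′
    covers (inj₂ (edge L′ n′ q′ p′)) with line-of-end L (inj₁ ≡.refl) p L′ p′
    ... | ≡.refl , ≡.refl = contradiction (j<k n′) λ ()
  degree-end {v = v} L (inj₂ ≡.refl) p with down L p (ℕ.s≤s ℕ.z≤n)
  ... | k , w , n , q = enumerate (w ∷ []) ([] ∷ []) (inj₂ (edge L n q p) ∷ []) (here ∘ covers)
    where
    covers : Adj v u → w ≡ u
    covers (inj₁ (edge L′ n′ p′ q′)) with line-of-end L (inj₂ ≡.refl) p L′ p′
    ... | ≡.refl , ≡.refl = contradiction (∈-bound q′) (ℕ.<⇒≱ (j<k n′))
    covers (inj₂ (edge L′ n′ q′ p′)) with line-of-end L (inj₂ ≡.refl) p L′ p′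
    ... | ≡.refl , ≡.refl with next-injective n n′
    ...   | ≡.refl = ∈-unique q q′

  record Through (v : Vertex) (c j : ℕ) : Set where
    field
      {above below}   : ℕ
      {upper lower}   : Vertex
      isLine          : Line c
      here∈           : v ∈[ c , j ]
      next-above      : Next c j above
      next-below      : Next c below j
      upper∈          : upper ∈[ c , above ]
      lower∈          : lower ∈[ c , below ]

    upper-adj : Adj v upper
    upper-adj = inj₁ (edge isLine next-above here∈ upper∈)

    lower-adj : Adj v lower
    lower-adj = inj₂ (edge isLine next-below lower∈ here∈)

    upper≢lower : upper ≢ lower
    upper≢lower eq = ℕ.<⇒≢ (ℕ.<-trans (j<k next-below) (j<k next-above))
      (∈-same-line lower∈ (≡.subst (_∈[ c , above ]) eq upper∈))

    upper-unique : Next c j k → w ∈[ c , k ] → upper ≡ w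
    upper-unique n q with next-functional next-above n
    ... | ≡.refl = ∈-unique upper∈ q

    lower-unique : Next c k j → w ∈[ c , k ] → lower ≡ w
    lower-unique n q with next-injective next-below n
    ... | ≡.refl = ∈-unique lower∈ q

  through : Line c → Line j → v ∈[ c , j ] → Through v c j
  through L (1≤j , j≤m) p with up L p j≤m | down L p 1≤j
  ... | _ , _ , n , q | _ , _ , n′ , q′ = record
    { isLine = L ; here∈ = p ; next-above = n ; next-below = n′ ; upper∈ = q ; lower∈ = q′ }

  -- The only vertex on both lines is {a , b}, and `k ≢ b` says that `u` is a different one. This
  -- separates neighbours along one line from neighbours along the other.
  crossing-apart : v ∈[ a , b ] → k ≢ b → u ∈[ a , k ] → w ∈[ b , l ] → u ≢ w
  crossing-apart p k≢b q r ≡.refl with ∈-determines q r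
  ... | inj₁ (a≡b , _) = ∈-≢ p a≡b
  ... | inj₂ (_ , k≡b) = k≢b k≡b

  module _ (along : Through v a b) (across : Through v b a) where
    private
      module A = Through along
      module B = Through across

    neighbours : Vec Vertex 4
    neighbours = A.upper ∷ A.lower ∷ B.upper ∷ B.lower ∷ []

    neighbours-unique : Unique neighbours
    neighbours-unique =
        (A.upper≢lower ∷ apart above≢ A.upper∈ B.upper∈ ∷ apart above≢ A.upper∈ B.lower∈ ∷ [])
      ∷ (apart below≢ A.lower∈ B.upper∈ ∷ apart below≢ A.lower∈ B.lower∈ ∷ [])
      ∷ (B.upper≢lower ∷ [])
      ∷ [] ∷ []
      where
      apart : k ≢ b → u ∈[ a , k ] → w ∈[ b , l ] → u ≢ w
      apart = crossing-apart A.here∈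
      above≢ : A.above ≢ b
      above≢ = ℕ.<⇒≢ (j<k A.next-above) ∘ ≡.sym
      below≢ : A.below ≢ b
      below≢ = ℕ.<⇒≢ (j<k A.next-below)

    degree-interior : Enumeration (Adj v) 4
    degree-interior = enumerate neighbours neighbours-unique
      (A.upper-adj ∷ A.lower-adj ∷ B.upper-adj ∷ B.lower-adj ∷ []) covers
      where
      covers : Adj v w → Any (_≡ w) neighbours
      covers (inj₁ (edge L n p q)) with ∈-determines A.here∈ p
      ... | inj₁ (≡.refl , ≡.refl) = here (A.upper-unique n q)
      ... | inj₂ (≡.refl , ≡.refl) = there (there (here (B.upper-unique n q)))
      covers (inj₂ (edge L n q p)) with ∈-determines A.here∈ p
      ... | inj₁ (≡.refl , ≡.refl) = there (here (A.lower-unique n q))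
      ... | inj₂ (≡.refl , ≡.refl) = there (there (there (here (B.lower-unique n q))))

  not-boundary : Line a → Line b → v ∈[ a , b ] → ¬ Enumeration (Adj v) 1
  not-boundary L M p one = contradiction
    (enumeration-unique (degree-interior (through L M p) (through M L (∈-swap p))) one) λ ()

  endLabel : Fin 2 → ℕ
  endLabel zero       = 0
  endLabel (suc zero) = ℕ.suc m

  lineOf : (i : Fin m) → Line (ℕ.suc (Fin.toℕ i))
  lineOf i = ℕ.s≤s ℕ.z≤n , Fin.toℕ<n i

  endpoint-exists : ∀ i e → ∃[ v ] v ∈[ ℕ.suc (Fin.toℕ i) , endLabel e ]
  endpoint-exists i zero       = point (lineOf i) (λ ()) ℕ.z≤n
  endpoint-exists i (suc zero) = point (lineOf i) (ℕ.<⇒≢ (ℕ.s<s (Fin.toℕ<n i))) ℕ.≤-refl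

  endpoint : Fin m × Fin 2 → Vertex
  endpoint (i , e) = proj₁ (endpoint-exists i e)

  endpoint∈ : ∀ i e → endpoint (i , e) ∈[ ℕ.suc (Fin.toℕ i) , endLabel e ]
  endpoint∈ i e = proj₂ (endpoint-exists i e)

  extreme : ∀ e → endLabel e ≡ 0 ⊎ endLabel e ≡ ℕ.suc m
  extreme zero       = inj₁ ≡.refl
  extreme (suc zero) = inj₂ ≡.refl

  endpoint-injective : ∀ x y → endpoint x ≡ endpoint y → x ≡ y
  endpoint-injective (i , e) (i′ , e′) eq
    with line-of-end (lineOf i) (extreme e) (endpoint∈ i e) (lineOf i′)
           (≡.subst (_∈[ _ , _ ]) (≡.sym eq) (endpoint∈ i′ e′))
  ... | c≡ , j≡ = ≡.cong₂ _,_ (Fin.toℕ-injective (ℕ.suc-injective (≡.sym c≡))) (label-injective e e′ (≡.sym j≡))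
    where
    label-injective : ∀ e e′ → endLabel e ≡ endLabel e′ → e ≡ e′
    label-injective zero       zero       _ = ≡.refl
    label-injective zero       (suc zero) ()
    label-injective (suc zero) (suc zero) _ = ≡.refl

  boundary : Enumeration (λ v → Enumeration (Adj v) 1) (m ℕ.* 2)
  boundary = record
    { elem      = endpoint ∘ Inverse.to pairs
    ; injective = λ eq → Injection.injective (↔⇒↣ pairs) (endpoint-injective _ _ eq)
    ; sound     = λ x → let i , e = Inverse.to pairs x in degree-end (lineOf i) (extreme e) (endpoint∈ i e)
    ; complete  = λ one → find (kind _) one
    }
    where
    pairs : Fin (m ℕ.* 2) ↔ (Fin m × Fin 2)
    pairs = Fin.*↔×
    label : ∀ {j} → j ≡ 0 ⊎ j ≡ ℕ.suc m → ∃[ e ] endLabel e ≡ j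
    label (inj₁ ≡.refl) = zero , ≡.refl
    label (inj₂ ≡.refl) = suc zero , ≡.refl
    find : Kind v → Enumeration (Adj v) 1 → ∃[ x ] endpoint (Inverse.to pairs x) ≡ v
    find (interior _ _ L M p) one = contradiction one (not-boundary L M p)
    find {v} (end (ℕ.suc c) j (_ , c<m) j-extreme p) _ with label j-extreme
    ... | e , ≡.refl = Inverse.from pairs (i , e) ,
      ≡.trans (≡.cong endpoint (Inverse.strictlyInverseˡ pairs (i , e)))
        (∈-unique (≡.subst (λ c → endpoint (i , e) ∈[ ℕ.suc c , endLabel e ]) (Fin.toℕ-fromℕ< c<m) (endpoint∈ i e)) p)
      where
      i : Fin m
      i = Fin.fromℕ< c<m

  count : Fin (m C 2 ℕ.+ m ℕ.* 2) ↔ Vertex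
  count = ≡.subst (λ N → Fin N ↔ Vertex) size ((↔-sym (Pair↔Fin (ℕ.suc m)) ⊎-↔ ↔-refl) ↔-∘ Fin.+↔⊎)
    where
    open ≡.≡-Reasoning
    size : ℕ.suc m C 2 ℕ.+ m ≡ m C 2 ℕ.+ m ℕ.* 2
    size = begin
      ℕ.suc m C 2 ℕ.+ m    ≡⟨ ≡.cong (ℕ._+ m) ([1+m]C2≡mC2+m m) ⟩
      m C 2 ℕ.+ m ℕ.+ m    ≡⟨ solve 2 (λ m c → c :+ m :+ m := c :+ m :* con 2) ≡.refl m (m C 2) ⟩
      m C 2 ℕ.+ m ℕ.* 2    ∎
      where open +-*-Solver

-- Lower bound: the choice of slopes.

-- Iterating the Lorentz boost with entries 1 + h, 3h, where 4h = 1, on (0 , 1)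
-- gives slopes q for which 1 + q² is a square, so no square roots are needed.
module Slopes (𝓡 : RealField) where
  open OrderedField 𝓡

  0<4 : 0# < (1# + 1#) + (1# + 1#)
  0<4 = +-pos (+-pos 0<1 0<1) (+-pos 0<1 0<1)

  h : Carrier
  h = proj₁ (posInverse 0<4)

  0<h : 0# < h
  0<h = proj₁ (proj₂ (posInverse 0<4))

  4h≈1 : ((1# + 1#) + (1# + 1#)) * h ≈ 1#
  4h≈1 = proj₂ (proj₂ (posInverse 0<4))

  q r : ℕ → Carrier
  q ℕ.zero    = 0#
  q (ℕ.suc i) = q i + (h * q i + (h + h + h) * r i)
  r ℕ.zero    = 1#
  r (ℕ.suc i) = r i + (h * r i + (h + h + h) * q i)

  0≤h : 0# ≤ h
  0≤h = inj₁ 0<h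

  0<3h : 0# < h + h + h
  0<3h = +-pos (+-pos 0<h 0<h) 0<h

  0≤q : ∀ i → 0# ≤ q i
  0<r : ∀ i → 0# < r i
  0≤q ℕ.zero    = inj₂ ≈-refl
  0≤q (ℕ.suc i) = +-nonneg (0≤q i) (+-nonneg (*-nonneg 0≤h (0≤q i)) (inj₁ (*-pos 0<3h (0<r i))))
  0<r ℕ.zero    = 0<1
  0<r (ℕ.suc i) = <-≤-trans (0<r i) (0≤y-x⇒x≤y (≤-respʳ-≈ (difference (r i) _)
    (+-nonneg (*-nonneg 0≤h (inj₁ (0<r i))) (*-nonneg (inj₁ 0<3h) (0≤q i)))))
    where
    difference : ∀ x y → y ≈ (x + y) - x
    difference = solve 2 (λ x y → y := (x :+ y) :- x) ≈-refl

  -- The boost multiplies `r² - q²` by (1 + h)² - (3h)² = 1 - 2h (4h - 1), which is 1 at h = 1/4.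
  -- The entries 5/4 and 3/4 come from the triangle 3, 4, 5.
  r²≈1+q² : ∀ i → r i * r i ≈ 1# + q i * q i
  r²≈1+q² ℕ.zero    = solve 0 (con (1 , 0) :* con (1 , 0) := con (1 , 0) :+ con (0 , 0) :* con (0 , 0)) ≈-refl
  r²≈1+q² (ℕ.suc i) = x-y≈0⇒x≈y _ _ (≈-trans
    (solve 3 (λ h q r →
      let q′ = q :+ (h :* q :+ (h :+ h :+ h) :* r)
          r′ = r :+ (h :* r :+ (h :+ h :+ h) :* q)
          I  = con (1 , 0)
          F  = ((I :+ I) :+ (I :+ I)) :* h :- I
      in r′ :* r′ :- (I :+ q′ :* q′)
         := (r :* r :- (I :+ q :* q)) :+ :- ((h :+ h) :* F :* (r :* r :- q :* q))) ≈-refl h (q i) (r i))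
    (≈-trans (+-cong (x≈y⇒x-y≈0 (r²≈1+q² i))
        (-‿cong (≈-trans (*-congʳ (≈-trans (*-congˡ (x≈y⇒x-y≈0 4h≈1)) (zeroʳ _))) (zeroˡ _))))
      (-‿inverseʳ 0#)))

  q-step : ∀ i → q i < q (ℕ.suc i)
  q-step i = 0<y-x⇒x<y (<-respʳ-≈ (difference (q i) _)
    (≤-<-trans (*-nonneg 0≤h (0≤q i)) (<-respˡ-≈ (+-identityʳ _) (<-respˡ-≈ (+-comm _ _)
      (<-respʳ-≈ (+-comm _ _) (+-mono-< (h * q i) (*-pos 0<3h (0<r i))))))))
    where
    difference : ∀ x y → y ≈ (x + y) - x
    difference = solve 2 (λ x y → y := (x :+ y) :- x) ≈-refl

  q-mono-< : ∀ {i j} → i ℕ.< j → q i < q j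
  q-mono-< {i} {ℕ.suc j} i<1+j with ℕ.m<1+n⇒m<n∨m≡n i<1+j
  ... | inj₁ i<j    = <-trans (q-mono-< i<j) (q-step j)
  ... | inj₂ ≡.refl = q-step i

  q-mono-≤ : ∀ {i j} → i ℕ.≤ j → q i ≤ q j
  q-mono-≤ i≤j with ℕ.m≤n⇒m<n∨m≡n i≤j
  ... | inj₁ i<j    = inj₁ (q-mono-< i<j)
  ... | inj₂ ≡.refl = inj₂ ≈-refl

  q-reflects-≤ : ∀ {i j} → q i ≤ q j → i ℕ.≤ j
  q-reflects-≤ {i} {j} qi≤qj with ℕ.<-≤-connex j i
  ... | inj₁ j<i = contradiction (<-≤-trans (q-mono-< j<i) qi≤qj) (irrefl ≈-refl)
  ... | inj₂ i≤j = i≤j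

  q-injective : ∀ {i j} → q i ≈ q j → i ≡ j
  q-injective e = ℕ.≤-antisym (q-reflects-≤ (inj₂ e)) (q-reflects-≤ (inj₂ (≈-sym e)))

-- Lower bound: drawing the arrangement with tangents.

-- The tangent at parameter s to the parabola { (2s , s²) } is { (s + t , s t) }, and
-- it meets the tangent at t in (s + t , s t).
module TangentGraph (𝓡 : RealField) (m : ℕ) where
  open OrderedField 𝓡
  open Plane 𝓡
  open PlaneVectors 𝓡
  open Slopes 𝓡
  open LineArrangement m

  private variable
    c j k l : ℕ
    u v w : Vertex
    X : Point
    s s′ t t′ : Carrier

  meet : Carrier → Carrier → Point
  meet s t = s + t , s * t

  meet-comm : ∀ s t → meet s t ≈ₚ meet t s
  meet-comm s t = +-comm s t , *-comm s t

  -- s + t = s′ + t′ and s t = s′ t′ give (s - s′) (t - s′) = 0.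
  meet-≢ : ¬ s ≈ s′ → meet s t ≈ₚ meet s′ t′ → t ≈ s′
  meet-≢ {s} {s′} {t} {t′} s≉s′ (e , f) = x-y≈0⇒x≈y _ _ (*-cancelˡ-≉0 (s≉s′ ∘ x-y≈0⇒x≈y s s′)
    (≈-trans (solve 4 (λ s t s′ t′ → (s :- s′) :* (t :- s′)
        := (s :* t :- s′ :* t′) :- s′ :* ((s :+ t) :- (s′ :+ t′))) ≈-refl s t s′ t′)
      (≈-trans (+-cong (x≈y⇒x-y≈0 f) (-‿cong (≈-trans (*-congˡ (x≈y⇒x-y≈0 e)) (zeroʳ s′)))) (-‿inverseʳ 0#))))

  meet-cancelˡ : meet s t ≈ₚ meet s t′ → t ≈ t′
  meet-cancelˡ {s} {t} {t′} (e , _) = x-y≈0⇒x≈y t t′ (≈-trans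
    (solve 3 (λ s t t′ → t :- t′ := (s :+ t) :- (s :+ t′)) ≈-refl s t t′) (x≈y⇒x-y≈0 e))

  position : Vertex → Point
  position v = meet (q (lo v)) (q (hi v))

  position-∈ : v ∈[ c , j ] → position v ≈ₚ meet (q c) (q j)
  position-∈ (low ≡.refl ≡.refl)  = ≈-refl , ≈-refl
  position-∈ (high ≡.refl ≡.refl) = meet-comm _ _

  position-injective : position v ≈ₚ position w → v ≡ w
  position-injective {v} {w} h with lo v ℕ.≟ lo w
  ... | yes e = ext v w e (q-injective (meet-cancelˡ
    (≈ₚ-trans h (≈ₚ-reflexive (≡.cong (λ l → meet (q l) (q (hi w))) (≡.sym e))))))
  -- If the lower labels differ, `meet-≢` identifies each higher label with the lower label of the
  -- other vertex, and `lo<hi` closes a cycle.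
  ... | no lo≢lo = contradiction
    (ℕ.<-trans (lo<hi v) (≡.subst₂ ℕ._<_ (≡.sym hv≡lw) (≡.sym lv≡hw) (lo<hi w))) (ℕ.n≮n _)
    where
    hv≡lw : hi v ≡ lo w
    hv≡lw = q-injective (meet-≢ (lo≢lo ∘ q-injective) h)
    lv≡hw : lo v ≡ hi w
    lv≡hw = ≡.sym (q-injective (meet-≢ (lo≢lo ∘ ≡.sym ∘ q-injective) (≈ₚ-sym h)))

  record Located (u v : Vertex) (X : Point) : Set where
    field
      {line from to} : ℕ
      isLine    : Line line
      next      : Next line from to
      parameter : Carrier
      lower     : q from ≤ parameter
      upper     : parameter ≤ q to
      on-line   : X ≈ₚ meet (q line) parameter
      ends      : (u ∈[ line , from ] × v ∈[ line , to ]) ⊎ (u ∈[ line , to ] × v ∈[ line , from ])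

  -- For fixed `s`, `meet s t` is affine in `t`; hence the point at fraction θ of the edge has the
  -- parameter at fraction θ between `q j` and `q k`.
  locateᵉ : Edge u v → OnSegment (position u) (position v) X → Located u v X
  locateᵉ {u} {v} {X} (edge {c} {j} {k} L n p p′) (θ , 0≤θ , θ≤1 , e , f) = record
    { isLine    = L
    ; next      = n
    ; parameter = q j + θ * (q k - q j)
    ; lower     = 0≤y-x⇒x≤y (≤-respʳ-≈ (solve 3 (λ θ a b → θ :* (b :- a) := (a :+ θ :* (b :- a)) :- a)
                    ≈-refl θ (q j) (q k))
                    (*-nonneg 0≤θ 0≤qk-qj))
    ; upper     = 0≤y-x⇒x≤y (≤-respʳ-≈ (solve 3 (λ θ a b → (con (1 , 0) :- θ) :* (b :- a)
                    := b :- (a :+ θ :* (b :- a)))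
                    ≈-refl θ (q j) (q k))
                    (*-nonneg (x≤y⇒0≤y-x θ≤1) 0≤qk-qj))
    ; on-line   = ≈-trans e (≈-trans (+-cong (proj₁ pu) (*-congˡ (+-cong (proj₁ pv) (-‿cong (proj₁ pu)))))
                    (solve 4 (λ c a b θ → (c :+ a) :+ θ :* ((c :+ b) :- (c :+ a))
                         := c :+ (a :+ θ :* (b :- a)))
                         ≈-refl (q c) (q j) (q k) θ))
                , ≈-trans f (≈-trans (+-cong (proj₂ pu) (*-congˡ (+-cong (proj₂ pv) (-‿cong (proj₂ pu)))))
                    (solve 4 (λ c a b θ → (c :* a) :+ θ :* ((c :* b) :- (c :* a))
                         := c :* (a :+ θ :* (b :- a)))
                         ≈-refl (q c) (q j) (q k) θ))
    ; ends      = inj₁ (p , p′)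
    }
    where
    pu : position u ≈ₚ meet (q c) (q j)
    pu = position-∈ p
    pv : position v ≈ₚ meet (q c) (q k)
    pv = position-∈ p′
    0≤qk-qj : 0# ≤ q k - q j
    0≤qk-qj = inj₁ (x<y⇒0<y-x (q-mono-< (Next.j<k n)))

  locate : Adj u v → OnSegment (position u) (position v) X → Located u v X
  locate (inj₁ e) X∈ = locateᵉ e X∈
  locate (inj₂ e) X∈ = record { Located (locateᵉ e (OnSegment-sym X∈)) ; ends = Sum.map Product.swap Product.swap
    (Sum.swap (Located.ends (locateᵉ e (OnSegment-sym X∈)))) }

  module _ (loc : Located u v X) where
    open Located loc

    end-at : l ≡ from ⊎ l ≡ to → ∃[ w ] w ∈[ line , l ] × (w ≡ u ⊎ w ≡ v)
    end-at (inj₁ ≡.refl) = [ (λ { (p , _) → _ , p , inj₁ ≡.refl }) , (λ { (_ , p) → _ , p , inj₂ ≡.refl }) ]′ ends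
    end-at (inj₂ ≡.refl) = [ (λ { (_ , p) → _ , p , inj₂ ≡.refl }) , (λ { (p , _) → _ , p , inj₁ ≡.refl }) ]′ ends

    -- No label other than `line` lies strictly between those of consecutive points, so a parameter
    -- `q l` on the edge must be at one of its two ends.
    at-vertex : l ≢ line → parameter ≈ q l → ∃[ w ] X ≈ₚ position w × w ∈[ line , l ] × (w ≡ u ⊎ w ≡ v)
    at-vertex {l} l≢c t≈ql =
      let w , w∈ , w∈uv = end-at (Sum.map
            (λ l≤j → ℕ.≤-antisym l≤j (q-reflects-≤ (≤-respʳ-≈ t≈ql lower)))
            (λ k≤l → ℕ.≤-antisym (q-reflects-≤ (≤-respˡ-≈ t≈ql upper)) k≤l)
            (Next.splits next l≢c))
      in w , ≈ₚ-trans on-line (≈ₚ-trans (+-congˡ t≈ql , *-congˡ t≈ql) (≈ₚ-sym (position-∈ w∈))) , w∈ , w∈uv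

  SameEdge : Vertex → Vertex → Vertex → Vertex → Set
  SameEdge a b c d = (a ≡ c × b ≡ d) ⊎ (a ≡ d × b ≡ c)

  Shared : Vertex → Vertex → Vertex → Vertex → Point → Set
  Shared a b c d X = ∃[ v ] X ≈ₚ position v × (v ≡ a ⊎ v ≡ b) × (v ≡ c ⊎ v ≡ d)

  shared-at : ∀ {a b c d} (L : Located a b X) (M : Located c d X) {l l′} →
    l ≢ Located.line L → Located.parameter L ≈ q l → l′ ≢ Located.line M → Located.parameter M ≈ q l′ →
    (∀ {v} → v ∈[ Located.line M , l′ ] → v ∈[ Located.line L , l ]) → Shared a b c d X
  shared-at L M l≢ e l′≢ e′ same with at-vertex L l≢ e | at-vertex M l′≢ e′
  ... | v , X≈v , v∈ , v∈ab | w , _ , w∈ , w∈cd with ∈-unique v∈ (same w∈)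
  ...   | ≡.refl = v , X≈v , v∈ab , w∈cd

  -- On one line the edge that starts earlier ends no later than the other one starts. The common
  -- point is squeezed between these two places, so it is the end of the first edge.
  consecutive : ∀ {a b c d} (L : Located a b X) (M : Located c d X) → Located.line L ≡ Located.line M →
    Located.from L ℕ.< Located.from M → Shared a b c d X
  consecutive {X = X} {a} {b} L M ≡.refl j<j′ with Next.splits (Located.next L) (Next.j≢c (Located.next M))
  ... | inj₁ j′≤j = contradiction j<j′ (ℕ.≤⇒≯ j′≤j)
  ... | inj₂ k≤j′ = shared-at L M (Next.k≢c L.next) t≈qk (Next.k≢c L.next) (≈-trans (≈-sym t≈t′) t≈qk) (λ p → p)
    where
    module L = Located L
    module M = Located M
    t≈t′ : L.parameter ≈ M.parameter
    t≈t′ = meet-cancelˡ (≈ₚ-trans (≈ₚ-sym L.on-line) M.on-line)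
    t≈qk : L.parameter ≈ q L.to
    t≈qk = ≤-antisym L.upper (≤-trans (q-mono-≤ k≤j′) (≤-trans M.lower (inj₂ (≈-sym t≈t′))))

  same-edge : ∀ {a b c d} (L : Located a b X) (M : Located c d X) → Located.line L ≡ Located.line M →
    Located.from L ≡ Located.from M → SameEdge a b c d
  same-edge L M ≡.refl ≡.refl with next-functional (Located.next L) (Located.next M)
  ... | ≡.refl with Located.ends L | Located.ends M
  ...   | inj₁ (p , p′) | inj₁ (r , r′) = inj₁ (∈-unique p r , ∈-unique p′ r′)
  ...   | inj₁ (p , p′) | inj₂ (r , r′) = inj₂ (∈-unique p r′ , ∈-unique p′ r)
  ...   | inj₂ (p , p′) | inj₁ (r , r′) = inj₂ (∈-unique p r′ , ∈-unique p′ r)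
  ...   | inj₂ (p , p′) | inj₂ (r , r′) = inj₁ (∈-unique p r , ∈-unique p′ r′)

  crossing : ∀ {a b c d} → ¬ SameEdge a b c d → Located a b X → Located c d X → Shared a b c d X
  crossing ¬same L M with Located.line L ℕ.≟ Located.line M
  -- On different lines, `meet-≢` shows that the parameter of the point on each line is that of the
  -- other line: the point is the vertex {c , c′}.
  ... | no c≢c′ = shared-at L M (c≢c′ ∘ ≡.sym)
    (meet-≢ (c≢c′ ∘ q-injective) (≈ₚ-trans (≈ₚ-sym L.on-line) M.on-line)) c≢c′
    (meet-≢ (c≢c′ ∘ ≡.sym ∘ q-injective) (≈ₚ-trans (≈ₚ-sym M.on-line) L.on-line)) ∈-swap
    where
    module L = Located L
    module M = Located M
  ... | yes c≡c′ with ℕ.<-cmp (Located.from L) (Located.from M)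
  ...   | tri< j<j′ _ _ = consecutive L M c≡c′ j<j′
  ...   | tri≈ _ j≡j′ _ = contradiction (same-edge L M c≡c′ j≡j′) ¬same
  ...   | tri> _ _ j′<j = let v , X≈v , v∈cd , v∈ab = consecutive M L (≡.sym c≡c′) j′<j in v , X≈v , v∈ab , v∈cd

  private
    -- All parameters lie between 0 and `M`, so the coordinates are at most 2M and M²; adding 1
    -- makes the bound strict.
    M ρ : Carrier
    M = q (ℕ.suc m)
    ρ = ((M + M) * (M + M) + (M * M) * (M * M)) + 1#

  meet-bounded : 0# ≤ s → s ≤ M → 0# ≤ t → t ≤ M → X ≈ₚ meet s t → ∥ X ∥² < ρ
  meet-bounded {s} {t} 0≤s s≤M 0≤t t≤M (e , f) = ≤-<-trans
    (≤-respˡ-≈ (+-cong (*-cong (≈-sym e) (≈-sym e)) (*-cong (≈-sym f) (≈-sym f)))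
      (+-mono-≤ (square (+-nonneg 0≤s 0≤t) (+-mono-≤ s≤M t≤M))
        (square (*-nonneg 0≤s 0≤t) (*-mono-≤ 0≤s s≤M 0≤t t≤M))))
    (0<y-x⇒x<y (<-respʳ-≈ (solve 1 (λ x → con (1 , 0) := (x :+ con (1 , 0)) :- x) ≈-refl _) 0<1))
    where
    square : ∀ {a b} → 0# ≤ a → a ≤ b → a * a ≤ b * b
    square 0≤a a≤b = *-mono-≤ 0≤a a≤b 0≤a a≤b

  vertex-bounded : ∀ v → X ≈ₚ position v → ∥ X ∥² < ρ
  vertex-bounded v = meet-bounded (0≤q (lo v)) (q-mono-≤ (ℕ.<⇒≤ (ℕ.<-≤-trans (lo<hi v) (hi≤1+m v))))
    (0≤q (hi v)) (q-mono-≤ (hi≤1+m v))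

  edge-bounded : Located u v X → ∥ X ∥² < ρ
  edge-bounded L = meet-bounded (0≤q line) (q-mono-≤ (ℕ.m≤n⇒m≤1+n (proj₂ isLine)))
    (≤-trans (0≤q from) lower) (≤-trans upper (q-mono-≤ (∈-bound (proj₁ (proj₂ (end-at L (inj₂ ≡.refl))))))) on-line
    where open Located L

  r⁻¹ : ∀ c → ∃[ x ] 0# < x × r c * x ≈ 1#
  r⁻¹ c = posInverse (0<r c)

  -- The direction (1 , q c) of tangent `c`, divided by its length `r c`.
  unit : ℕ → Point
  unit c = proj₁ (r⁻¹ c) , q c * proj₁ (r⁻¹ c)

  unit-norm : ∀ c → ∥ unit c ∥² ≈ 1#
  unit-norm c = begin
    x * x + (q c * x) * (q c * x)  ≈⟨ solve 2 (λ x q → x :* x :+ (q :* x) :* (q :* x)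
                    := (con (1 , 0) :+ q :* q) :* (x :* x))
                    ≈-refl x (q c) ⟩
    (1# + q c * q c) * (x * x)     ≈⟨ *-congʳ (r²≈1+q² c) ⟨
    (r c * r c) * (x * x)          ≈⟨ solve 2 (λ r x → (r :* r) :* (x :* x) := (r :* x) :* (r :* x))
                    ≈-refl (r c) x ⟩
    (r c * x) * (r c * x)          ≈⟨ *-cong rx≈1 rx≈1 ⟩
    1# * 1#                        ≈⟨ *-identityˡ 1# ⟩
    1#                             ∎
    where
    open SetoidReasoning setoid
    x : Carrier
    x = proj₁ (r⁻¹ c)
    rx≈1 : r c * x ≈ 1#
    rx≈1 = proj₂ (proj₂ (r⁻¹ c))

  unit-along : Next c j k → v ∈[ c , j ] → w ∈[ c , k ] → UnitVector (position v) (position w) (unit c)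
  -- The displacement is `q k - q j` times (1 , q c), which gives the length `(q k - q j) * r c`.
  unit-along {c} {j} {k} {v} {w} n p p′ = unit-norm c , (q k - q j) * r c ,
    *-pos (x<y⇒0<y-x (q-mono-< (Next.j<k n))) (0<r c) ,
    ≈-trans (+-cong (proj₁ pw) (-‿cong (proj₁ pv)))
      (≈-trans (solve 3 (λ c a b → (c :+ b) :- (c :+ a) := (b :- a) :* con (1 , 0))
                    ≈-refl (q c) (q j) (q k))
      (≈-trans (*-congˡ (≈-sym rx≈1)) (≈-sym (*-assoc _ _ _)))) ,
    ≈-trans (+-cong (proj₂ pw) (-‿cong (proj₂ pv)))
      (≈-trans (solve 3 (λ c a b → (c :* b) :- (c :* a) := (c :* (b :- a)) :* con (1 , 0))
                    ≈-refl (q c) (q j) (q k))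
      (≈-trans (*-congˡ (≈-sym rx≈1)) (solve 4 (λ c d r x → (c :* d) :* (r :* x) := (d :* r) :* (c :* x))
                      ≈-refl (q c) _ (r c) _)))
    where
    pv : position v ≈ₚ meet (q c) (q j)
    pv = position-∈ p
    pw : position w ≈ₚ meet (q c) (q k)
    pw = position-∈ p′
    rx≈1 : r c * proj₁ (r⁻¹ c) ≈ 1#
    rx≈1 = proj₂ (proj₂ (r⁻¹ c))

  degree : ∀ v → Enumeration (Adj v) 1 ⊎ Enumeration (Adj v) 4
  degree v with kind v
  ... | end _ _ L e p        = inj₁ (degree-end L e p)
  ... | interior _ _ L L′ p = inj₂ (degree-interior (through L L′ p) (through L′ L (∈-swap p)))

  no-degree-2 : ∀ v → ¬ Enumeration (Adj v) 2
  no-degree-2 v two = [ (λ one → contradiction (enumeration-unique two one) λ ())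
                      , (λ four → contradiction (enumeration-unique two four) λ ()) ]′ (degree v)

  tangentGraph : Graph
  tangentGraph = record
    { Vertex       = Vertex
    ; position     = position
    ; position-inj = position-injective
    ; countable    = mk↣ {to = Fin.toℕ ∘ Inverse.from count}
                       (λ e → Injection.injective (↔⇒↣ (↔-sym count)) (Fin.toℕ-injective e))
    ; Adj          = Adj
    ; adj-sym      = Sum.swap
    ; adj-irrefl   = λ { u≡v (inj₁ e) → edge-≢ e u≡v ; u≡v (inj₂ e) → edge-≢ e (≡.sym u≡v) }
    ; crossing     = λ ab cd ¬same X∈ab X∈cd → crossing ¬same (locate ab X∈ab) (locate cd X∈cd)
    ; no-degree-2  = no-degree-2
    ; bounded      = ρ , λ { X (inj₁ (v , X≈v)) → vertex-bounded v X≈v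
                           ; X (inj₂ (_ , _ , ab , X∈ab)) → edge-bounded (locate ab X∈ab) }
    }

  balanced : Line c → Line j → v ∈[ c , j ] → Balanced tangentGraph v
  balanced {c} {j} {v} L L′ p = 4 , degree-interior along across , lookup units , unit-vectors ,
    cancels (proj₁ (unit c)) (proj₁ (unit j)) , cancels (proj₂ (unit c)) (proj₂ (unit j))
    where
    along : Through v c j
    along = through L L′ p
    across : Through v j c
    across = through L′ L (∈-swap p)
    units : Vec Point 4
    units = unit c ∷ -ₚ unit c ∷ unit j ∷ -ₚ unit j ∷ []
    module A = Through along
    module B = Through across
    unit-vectors : ∀ i → UnitVector (position v) (position (lookup (neighbours along across) i)) (lookup units i)
    unit-vectors zero                   = unit-along A.next-above A.here∈ A.upper∈
    unit-vectors (suc zero)             = UnitVector-flip (unit-along A.next-below A.lower∈ A.here∈)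
    unit-vectors (suc (suc zero))       = unit-along B.next-above B.here∈ B.upper∈
    unit-vectors (suc (suc (suc zero))) = UnitVector-flip (unit-along B.next-below B.lower∈ B.here∈)
    cancels : ∀ x y → x + (- x + (y + (- y + 0#))) ≈ 0#
    cancels = solve 2 (λ x y → x :+ (:- x :+ (y :+ (:- y :+ con (0 , 0)))) := con (0 , 0)) ≈-refl

  critical : Critical tangentGraph
  critical v v° with kind v
  ... | end _ _ L e p        = contradiction (degree-end L e p) v°
  ... | interior _ _ L L′ p = balanced L L′ p

  regular : BoundaryRegular tangentGraph 4
  regular v v° = [ (λ one → contradiction one v°) , (λ four → four) ]′ (degree v)

  extremal : VertexCount 4 (m ℕ.* 2) (m C 2 ℕ.+ m ℕ.* 2)
  extremal = tangentGraph , critical , regular , boundary , count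

-- Binomial arithmetic and the conclusion.

2*mC2+m≡m² : ∀ m → 2 ℕ.* (m C 2) ℕ.+ m ≡ m ℕ.* m
2*mC2+m≡m² ℕ.zero    = ≡.refl
2*mC2+m≡m² (ℕ.suc m) = begin
  2 ℕ.* (ℕ.suc m C 2) ℕ.+ ℕ.suc m
    ≡⟨ ≡.cong (λ c → 2 ℕ.* c ℕ.+ ℕ.suc m) ([1+m]C2≡mC2+m m) ⟩
  2 ℕ.* (m C 2 ℕ.+ m) ℕ.+ ℕ.suc m
    ≡⟨ solve 2 (λ m c → con 2 :* (c :+ m) :+ (con 1 :+ m) := con 1 :+ con 2 :* m :+ (con 2 :* c :+ m))
           ≡.refl m (m C 2) ⟩
  1 ℕ.+ 2 ℕ.* m ℕ.+ (2 ℕ.* (m C 2) ℕ.+ m)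
    ≡⟨ ≡.cong (1 ℕ.+ 2 ℕ.* m ℕ.+_) (2*mC2+m≡m² m) ⟩
  1 ℕ.+ 2 ℕ.* m ℕ.+ m ℕ.* m
    ≡⟨ solve 1 (λ m → con 1 :+ con 2 :* m :+ m :* m := (con 1 :+ m) :* (con 1 :+ m)) ≡.refl m ⟩
  ℕ.suc m ℕ.* ℕ.suc m ∎
  where
  open ≡.≡-Reasoning
  open +-*-Solver

-- The number of slots is 4m² + 12m = 8 (C(m, 2) + 2m), so dividing by eight loses nothing and the
-- bound is exactly the size of the tangent graph.
slots-bound : ∀ m N → N ℕ.* 8 ℕ.≤ (m ℕ.* 2) ℕ.* (m ℕ.* 2) ℕ.+ (m ℕ.* 2) ℕ.* 6 → N ℕ.≤ m C 2 ℕ.+ m ℕ.* 2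
slots-bound m N bound = ℕ.*-cancelʳ-≤ N (m C 2 ℕ.+ m ℕ.* 2) 8 (ℕ.≤-trans bound (ℕ.≤-reflexive (begin
  (m ℕ.* 2) ℕ.* (m ℕ.* 2) ℕ.+ (m ℕ.* 2) ℕ.* 6
    ≡⟨ solve 1 (λ m → (m :* con 2) :* (m :* con 2) :+ (m :* con 2) :* con 6
                   := con 4 :* (m :* m) :+ con 12 :* m) ≡.refl m ⟩
  4 ℕ.* (m ℕ.* m) ℕ.+ 12 ℕ.* m
    ≡⟨ ≡.cong (λ s → 4 ℕ.* s ℕ.+ 12 ℕ.* m) (2*mC2+m≡m² m) ⟨
  4 ℕ.* (2 ℕ.* (m C 2) ℕ.+ m) ℕ.+ 12 ℕ.* m
    ≡⟨ solve 2 (λ m c → con 4 :* (con 2 :* c :+ m) :+ con 12 :* m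
                     := (c :+ m :* con 2) :* con 8) ≡.refl m (m C 2) ⟩
  (m C 2 ℕ.+ m ℕ.* 2) ℕ.* 8 ∎)))
  where
  open ≡.≡-Reasoning
  open +-*-Solver

open import Data.Nat using (_+_; _≤_; _/_)

theorem2 : (𝓡 : RealField) → let open Plane 𝓡 in
    ∀ (n : ℕ) → 3 ≤ n →
    (2 ∣ n → f[ 4 ]⟨ n ⟩≡ ((n / 2) C 2 + n)) ×
    (¬ (2 ∣ n) → (f[ 4 ]⟨ n ⟩≡ 0) × (∀ N → ¬ VertexCount 4 n N))
theorem2 𝓡 n _ = even , λ odd →
    ((λ N G → contradiction G (none odd N)) , λ _ _ → ℕ.z≤n) , none odd
  where
  open Plane 𝓡
  even : 2 ∣ n → f[ 4 ]⟨ n ⟩≡ ((n / 2) C 2 + n)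
  even (divides m ≡.refl) = ≡.subst (λ k → f[ 4 ]⟨ m ℕ.* 2 ⟩≡ (k C 2 + m ℕ.* 2)) (≡.sym (m*n/n≡m m 2))
    ( (λ { N (G , critical , regular , boundary , count) → slots-bound m N
             (FiniteCriticalGraph.8N≤n²+6n 𝓡 G critical regular (m ℕ.* 2) boundary N count) })
    , (λ b bound → bound (m C 2 + m ℕ.* 2) (TangentGraph.extremal 𝓡 m)) )
  none : ¬ (2 ∣ n) → ∀ N → ¬ VertexCount 4 n N
  none odd N (G , critical , regular , boundary , count) =
    odd (FiniteCriticalGraph.n-even 𝓡 G critical regular n boundary N count)
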